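{- Let $n\ge 2$. For any permutations $w,v\in S_n$, $$w\star v \;=\; h_{n-1,\,w_{\nwarrow n-1}}\circ h_{n-2,\,w_{\nwarrow n-2}}\circ\cdots\circ h_{2,\,w_{\nwarrow 2}}\circ h_{1,\,w_{\nwarrow 1}}\,(wv),$$ where $wv$ is the usual product, and the hopping operators are applied in the order $h_{1,\cdot}$ first, then $h_{2,\cdot}$, and so on up to $h_{n-1,\cdot}$.
   Context: $S_n$ is the symmetric group on $[n]=\{1,\dots,n\}$, with permutations written in one-line notation $w=w(1)w(2)\cdots w(n)$. Products are compositions, $(wv)(k)=w(v(k))$; thus left multiplication by $u$ replaces each entry $x$ of the one-line notation by $u(x)$. Let $s_i$ be the transposition $(i,i+1)$ for $1\le i\le n-1$ (the Coxeter generators), and let $\ell$ denote Coxeter length (the number of inversions). The Demazure product $\star$ on $S_n$ is the associative product determined by the following two rules: - $s_i\star u=u$ if $\ell(s_iu)<\ell(u)$, and $s_i\star u=s_iu$ otherwise; - $w\star u=s_{a_1}\star(s_{a_2}\star(\cdots\star(s_{a_k}\star u)))$ for any reduced word $w=s_{a_1}\cdots s_{a_k}$. Equivalently, $\star$ is the product of the monoid generated by the $s_i$ subject to the braid relations and $s_i\star s_i=s_i$. Hopping operator: let $t\in[n]$ and let $L$ be an ordered list of distinct elements of $[n]$. The map $h_{t,L}:S_n\to S_n$ acts on $w$ by the following iteration. - Consider the entries of the one-line notation of $w$ that lie to the right of $t$, belong to $L$, and are greater than $t$. - If there are none, output $w$. - Otherwise, let $q$ be the one among them that occurs latest in the ordered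 list $L$. Swap the positions of $t$ and $q$ in $w$, replace $w$ by the result, and repeat. For $w\in S_n$ and $a\in[n]$, $w_{\nwarrow a}$ denotes the ordered list obtained as follows: take the entries of the one-line notation of $w$ lying strictly to the left of the entry $a$, keep only those greater than $a$, and keep them in their order of appearance. -}

module Defs where

-- Conventions: [n] = {1,…,n} is modelled by Fin n = {0,…,n-1} (value i+1 ↦ i).
-- A permutation w ∈ S_n is a stdlib `Permutation′ n`; its one-line notation is
-- w(1)…w(n) = w ⟨$⟩ʳ 0, …, w ⟨$⟩ʳ (n-1), and `w ⟨$⟩ˡ a` is the position of entry a.

open import Data.Nat using (ℕ; zero; suc; _<ᵇ_)
open import Data.Fin using (Fin; toℕ; inject₁; suc)
open import Data.Fin.Permutation
  using (Permutation′; _⟨$⟩ʳ_; _⟨$⟩ˡ_; _∘ₚ_; transpose; _≈_; id)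
open import Data.List using (List; []; _∷_; filterᵇ; length; map; foldr; foldl; reverse; findᵇ; allFin; concatMap)
open import Data.Bool using (Bool; _∧_; if_then_else_)
open import Data.Maybe using (Maybe; just; nothing)
open import Data.Product using (_×_; _,_)
open import Relation.Binary.PropositionalEquality using (_≡_)

Perm : ℕ → Set
Perm n = Permutation′ n

-- The usual product: (w · v)(k) = w(v(k))   (stdlib `∘ₚ` is diagrammatic)
infixl 7 _·_
_·_ : ∀ {n} → Perm n → Perm n → Perm n
w · v = v ∘ₚ w

_<ꟳ_ : ∀ {n} → Fin n → Fin n → Bool
i <ꟳ j = toℕ i <ᵇ toℕ j

pos : ∀ {n} → Perm n → Fin n → Fin n
pos w a = w ⟨$⟩ˡ a

len : ∀ {n} → Perm n → ℕ
len {n} w = length (filterᵇ isInv pairs)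
  where
  pairs : List (Fin n × Fin n)
  pairs = concatMap (λ i → map (λ j → (i , j)) (allFin n)) (allFin n)
  isInv : Fin n × Fin n → Bool
  isInv (i , j) = (i <ꟳ j) ∧ ((w ⟨$⟩ʳ j) <ꟳ (w ⟨$⟩ʳ i))

-- The letter a : Fin k (0-based) stands for s_{a+1} = (a+1, a+2) in 1-based terms,
-- i.e. the transposition of the 0-based values a and a+1.

sgen : ∀ {k} → Fin k → Perm (suc k)
sgen a = transpose (inject₁ a) (suc a)

sStar : ∀ {k} → Fin k → Perm (suc k) → Perm (suc k)
sStar a u = if len (sgen a · u) <ᵇ len u then u else sgen a · u

demazureWord : ∀ {k} → List (Fin k) → Perm (suc k) → Perm (suc k)
demazureWord as u = foldr sStar u as

wordProd : ∀ {k} → List (Fin k) → Perm (suc k)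
wordProd as = foldr (λ a p → sgen a · p) id as

IsReducedWord : ∀ {k} → Perm (suc k) → List (Fin k) → Set
IsReducedWord w as = (wordProd as ≈ w) × (length as ≡ len w)

lastSuch : ∀ {A : Set} → (A → Bool) → List A → Maybe A
lastSuch p L = findᵇ p (reverse L)

-- one iteration: among entries q right of t, in L, with q > t, take the latest in L
-- and swap the positions of t and q (= left multiplication by the transposition (t q))
hopStep : ∀ {n} → Fin n → List (Fin n) → Perm n → Perm n
hopStep t L w with lastSuch (λ q → (t <ꟳ q) ∧ (pos w t <ꟳ pos w q)) L
... | nothing = w
... | just q  = transpose t q · w

-- Each effective step moves t strictly to the right, so at most n-1 steps occur;
-- iterating n times (the step is the identity once nothing qualifies) computes h_{t,L}.
iter : ∀ {A : Set} → ℕ → (A → A) → A → A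
iter zero    f x = x
iter (suc m) f x = iter m f (f x)

hop : ∀ {n} → Fin n → List (Fin n) → Perm n → Perm n
hop {n} t L w = iter n (hopStep t L) w

-- w_{↖a}: entries strictly left of a that are greater than a, in order of appearance
nwList : ∀ {n} → Perm n → Fin n → List (Fin n)
nwList {n} w a = filterᵇ (λ x → a <ꟳ x) (map (w ⟨$⟩ʳ_) (filterᵇ (λ i → i <ꟳ pos w a) (allFin n)))

-- h_{n-1, w↖(n-1)} ∘ ⋯ ∘ h_{1, w↖1} applied to x (h_1 first); the 1-based values
-- t = 1,…,n-1 are the 0-based values inject₁ a for a : Fin k, in increasing order.
hopAll : ∀ {k} → Perm (suc k) → Perm (suc k) → Perm (suc k)
hopAll {k} w x = foldl (λ u a → hop (inject₁ a) (nwList w (inject₁ a)) u) x (allFin k)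

-- Write H(w) for h_{n-1,w↖(n-1)} ∘ ⋯ ∘ h_{1,w↖1} (w v).  A hopping operator h_{t,L} is the composite of the
-- conditional transpositions "swap t with q if q > t stands to the right of t", taken over q ∈ L from the last
-- entry to the first.  If d is the largest descent of w, then below d the lists w↖t are the images under s_d of
-- the lists (s_d w)↖t, the list w↖d is d+1 followed by (s_d w)↖(d+1), and all later lists of w are empty; so the
-- hops of w and of s_d w agree up to relabelling by s_d, except for one conditional swap of d and d+1, which is
-- exactly s_d ⋆ _.  Hence H(w) = s_d ⋆ H(s_d w).  For a reduced word a·α of w, induction on ℓ(w) turns
-- s_a ⋆ (α ⋆ v) into s_a ⋆ H(s_a w), and s_a ⋆ H(s_a w) = s_d ⋆ H(s_d w) because s_a w and s_d w have reduced
-- words through s_a s_d w (or s_a s_d s_a w when a and d are adjacent), on which ⋆ satisfies the commutation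
-- and braid relations.  No appeal to Matsumoto's theorem is needed.

module Submission where

open import Defs
open import Data.Bool using (Bool; true; false; T; _∧_; if_then_else_)
open import Data.Bool.Properties using (T-≡)
open import Data.Empty using (⊥-elim)
open import Data.Fin using (Fin; toℕ; inject₁; zero; suc; fromℕ<)
open import Data.Fin.Properties using (toℕ-injective; toℕ-inject₁; toℕ<n; toℕ-fromℕ<; _≟_)
import Data.Fin.Properties as Finₚ
open import Data.Fin.Permutation using (_⟨$⟩ʳ_; _⟨$⟩ˡ_; inverseˡ; inverseʳ; transpose; _≈_; id)
import Data.Fin.Permutation.Components as PC
open import Data.List
  using ( List; []; _∷_; _++_; _∷ʳ_; length; map; foldr; foldl; filterᵇ; findᵇ; reverse; concatMap; cartesianProduct
        ; allFin; tabulate)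
open import Data.List.Properties using (map-∘; foldl-cong; foldr-∷ʳ; reverse-++)
open import Data.List.Membership.Propositional using (_∈_)
open import Data.List.Membership.Propositional.Properties using (∈-allFin; ∈-cartesianProduct⁺; ∈-filter⁺)
open import Data.List.Relation.Binary.Pointwise using (Pointwise; []; _∷_)
open import Data.List.Relation.Unary.All using (All; []; _∷_; lookup)
import Data.List.Relation.Unary.All as All
open import Data.List.Relation.Unary.All.Properties using (all-filter)
open import Data.List.Relation.Unary.AllPairs using (AllPairs; []; _∷_)
import Data.List.Relation.Unary.AllPairs.Properties as AllPairs
open import Data.List.Relation.Unary.Any using (here; there)
open import Data.List.Relation.Unary.Unique.Propositional using (Unique)
open import Data.List.Relation.Unary.Unique.Propositional.Properties using (cartesianProduct⁺; allFin⁺)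
open import Data.List.Reverse using (Reverse; []; _∶_∶ʳ_; reverseView)
open import Data.Maybe using (just; nothing; maybe′)
open import Data.Nat using (ℕ; zero; suc; _+_; _≤_; _<_; _<ᵇ_; _<?_; z≤n; s≤s)
open import Data.Nat.Properties
  using ( <ᵇ⇒<; <⇒<ᵇ; ≤∧≢⇒<; ≮⇒≥; <⇒≢; <⇒≤; <⇒≱; ≤⇒≯; <-irrefl; <-asym; <-trans; <-≤-trans; ≤-<-trans; ≤-refl; ≤-trans
        ; ≤-reflexive; ≤-antisym; ≤-pred; <-cmp; n≤1+n; n<1+n; m≤m+n; suc-injective; +-suc; +-identityʳ; +-monoʳ-≤)
import Data.Nat.Properties as ℕ
open import Data.Product using (Σ; _×_; _,_; proj₁; proj₂)
open import Data.Sum using (_⊎_; inj₁; inj₂; [_,_])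
open import Function using (_∘_; Equivalence)
open import Relation.Binary using (Setoid; IsEquivalence)
open import Relation.Binary.Definitions using (tri<; tri≈; tri>)
import Relation.Binary.Reasoning.Setoid as SetoidReasoning
open import Relation.Binary.PropositionalEquality hiding ([_])
open import Relation.Nullary using (¬_; Dec; yes; no; contradiction)
open import Relation.Nullary.Decidable using (T?)

<⇒<ᵇ≡true : ∀ {m n} → m < n → (m <ᵇ n) ≡ true
<⇒<ᵇ≡true = Equivalence.to T-≡ ∘ <⇒<ᵇ

<ᵇ≡true⇒< : ∀ {m n} → (m <ᵇ n) ≡ true → m < n
<ᵇ≡true⇒< {m} {n} = <ᵇ⇒< m n ∘ Equivalence.from T-≡

≮⇒<ᵇ≡false : ∀ {m n} → ¬ m < n → (m <ᵇ n) ≡ false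
≮⇒<ᵇ≡false {m} {n} m≮n with m <ᵇ n in eq
... | true  = contradiction (<ᵇ≡true⇒< eq) m≮n
... | false = refl

<ᵇ-cong : ∀ {m n m′ n′} → (m < n → m′ < n′) → (m′ < n′ → m < n) → (m <ᵇ n) ≡ (m′ <ᵇ n′)
<ᵇ-cong {m} {n} to from with m <ᵇ n in eq
... | true  = sym (<⇒<ᵇ≡true (to (<ᵇ≡true⇒< eq)))
... | false = sym (≮⇒<ᵇ≡false (λ p → contradiction (trans (sym (<⇒<ᵇ≡true (from p))) eq) λ ()))

<ᵇ-suc≡<ᵇ : ∀ m c → m ≢ c → (m <ᵇ suc c) ≡ (m <ᵇ c)
<ᵇ-suc≡<ᵇ m c m≢c = <ᵇ-cong (λ p → ≤∧≢⇒< (≤-pred p) m≢c) (λ p → <-trans p (n<1+n c))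

suc-<ᵇ≡<ᵇ : ∀ m c → m ≢ suc c → (suc c <ᵇ m) ≡ (c <ᵇ m)
suc-<ᵇ≡<ᵇ m c m≢1+c = <ᵇ-cong (<-trans (n<1+n c)) (λ p → ≤∧≢⇒< p (m≢1+c ∘ sym))

-- Transpositions and permutations

module _ {n : ℕ} where

  transpose-matchˡ : (i j : Fin n) → PC.transpose i j i ≡ j
  transpose-matchˡ i j with i ≟ i
  ... | yes _  = refl
  ... | no i≢i = ⊥-elim (i≢i refl)

  transpose-matchʳ : (i j : Fin n) → PC.transpose i j j ≡ i
  transpose-matchʳ i j with j ≟ i
  ... | yes j≡i = j≡i
  ... | no _ with j ≟ j
  ...   | yes _  = refl
  ...   | no j≢j = ⊥-elim (j≢j refl)

  transpose-mismatch : (i j x : Fin n) → x ≢ i → x ≢ j → PC.transpose i j x ≡ x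
  transpose-mismatch i j x x≢i x≢j with x ≟ i
  ... | yes x≡i = ⊥-elim (x≢i x≡i)
  ... | no _ with x ≟ j
  ...   | yes x≡j = ⊥-elim (x≢j x≡j)
  ...   | no _    = refl

  transpose-comm : (i j x : Fin n) → PC.transpose i j x ≡ PC.transpose j i x
  transpose-comm i j x = by-cases (x ≟ i) (x ≟ j)
    where
    by-cases : Dec (x ≡ i) → Dec (x ≡ j) → PC.transpose i j x ≡ PC.transpose j i x
    by-cases (yes refl) (yes refl) = refl
    by-cases (yes refl) (no _)     = trans (transpose-matchˡ x j) (sym (transpose-matchʳ j x))
    by-cases (no _)     (yes refl) = trans (transpose-matchʳ i x) (sym (transpose-matchˡ x i))
    by-cases (no x≢i)   (no x≢j)   =
      trans (transpose-mismatch i j x x≢i x≢j) (sym (transpose-mismatch j i x x≢j x≢i))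

  transpose-involutive : (i j x : Fin n) → PC.transpose i j (PC.transpose i j x) ≡ x
  transpose-involutive i j x = trans (transpose-comm i j (PC.transpose i j x)) (PC.transpose-inverse j i)

  >⇒≢ : ∀ {x y : Fin n} → toℕ y < toℕ x → x ≢ y
  >⇒≢ = ≢-sym ∘ Finₚ.<⇒≢

  ⟨$⟩ʳ-injective : (π : Perm n) {x y : Fin n} → π ⟨$⟩ʳ x ≡ π ⟨$⟩ʳ y → x ≡ y
  ⟨$⟩ʳ-injective π {x} {y} e = trans (sym (inverseˡ π)) (trans (cong (π ⟨$⟩ˡ_) e) (inverseˡ π))

  ⟨$⟩ˡ-injective : (π : Perm n) {x y : Fin n} → π ⟨$⟩ˡ x ≡ π ⟨$⟩ˡ y → x ≡ y
  ⟨$⟩ˡ-injective π {x} {y} e = trans (sym (inverseʳ π)) (trans (cong (π ⟨$⟩ʳ_) e) (inverseʳ π))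

  transpose-conjugate : (π : Perm n) (i j x : Fin n) →
                        PC.transpose (π ⟨$⟩ʳ i) (π ⟨$⟩ʳ j) (π ⟨$⟩ʳ x) ≡ π ⟨$⟩ʳ PC.transpose i j x
  transpose-conjugate π i j x = by-cases (x ≟ i) (x ≟ j)
    where
    by-cases : Dec (x ≡ i) → Dec (x ≡ j) →
               PC.transpose (π ⟨$⟩ʳ i) (π ⟨$⟩ʳ j) (π ⟨$⟩ʳ x) ≡ π ⟨$⟩ʳ PC.transpose i j x
    by-cases (yes refl) _          =
      trans (transpose-matchˡ (π ⟨$⟩ʳ x) (π ⟨$⟩ʳ j)) (cong (π ⟨$⟩ʳ_) (sym (transpose-matchˡ x j)))
    by-cases (no _)     (yes refl) =
      trans (transpose-matchʳ (π ⟨$⟩ʳ i) (π ⟨$⟩ʳ x)) (cong (π ⟨$⟩ʳ_) (sym (transpose-matchʳ i x)))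
    by-cases (no x≢i)   (no x≢j)   =
      trans (transpose-mismatch (π ⟨$⟩ʳ i) (π ⟨$⟩ʳ j) (π ⟨$⟩ʳ x) (x≢i ∘ ⟨$⟩ʳ-injective π) (x≢j ∘ ⟨$⟩ʳ-injective π))
            (cong (π ⟨$⟩ʳ_) (sym (transpose-mismatch i j x x≢i x≢j)))

  ≈-refl : {u : Perm n} → u ≈ u
  ≈-refl _ = refl

  ≈-sym : {u v : Perm n} → u ≈ v → v ≈ u
  ≈-sym p i = sym (p i)

  ≈-trans : {u v w : Perm n} → u ≈ v → v ≈ w → u ≈ w
  ≈-trans p q i = trans (p i) (q i)

  ≈-isEquivalence : IsEquivalence (_≈_ {n} {n})
  ≈-isEquivalence = record
    { refl = λ {u} → ≈-refl {u} ; sym = λ {u} {v} → ≈-sym {u} {v} ; trans = λ {u} {v} {w} → ≈-trans {u} {v} {w} }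

  ≈-setoid : Setoid _ _
  ≈-setoid = record { isEquivalence = ≈-isEquivalence }

  module ≈-Reasoning = SetoidReasoning ≈-setoid

  ≡⇒≈ : {u v : Perm n} → u ≡ v → u ≈ v
  ≡⇒≈ = Setoid.reflexive ≈-setoid

  ·-cong : {u u′ v v′ : Perm n} → u ≈ u′ → v ≈ v′ → u · v ≈ u′ · v′
  ·-cong {u} {v′ = v′} p q i = trans (cong (u ⟨$⟩ʳ_) (q i)) (p (v′ ⟨$⟩ʳ i))

  ·-congˡ : (u : Perm n) {v v′ : Perm n} → v ≈ v′ → u · v ≈ u · v′
  ·-congˡ u q i = cong (u ⟨$⟩ʳ_) (q i)

  pos-cong : {u v : Perm n} → u ≈ v → ∀ x → pos u x ≡ pos v x
  pos-cong {u} {v} p x = ⟨$⟩ʳ-injective u (trans (inverseʳ u) (trans (sym (inverseʳ v)) (sym (p (pos v x)))))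

  pos-· : (π u : Perm n) (x : Fin n) → pos (π · u) (π ⟨$⟩ʳ x) ≡ pos u x
  pos-· π u x = cong (pos u) (inverseˡ π)

  transpose-·-involutive : (i j : Fin n) (u : Perm n) → transpose i j · (transpose i j · u) ≈ u
  transpose-·-involutive i j u x = transpose-involutive i j (u ⟨$⟩ʳ x)

-- Length and descents

module _ {A : Set} where

  filterᵇ-cong : {f g : A → Bool} {xs : List A} → All (λ x → f x ≡ g x) xs → filterᵇ f xs ≡ filterᵇ g xs
  filterᵇ-cong [] = refl
  filterᵇ-cong {f} {g} {x ∷ _} (e ∷ es) with f x | g x | e
  ... | true  | true  | refl = cong (x ∷_) (filterᵇ-cong es)
  ... | false | false | refl = filterᵇ-cong es

  filterᵇ-none : {p : A → Bool} {xs : List A} → All (λ x → p x ≡ false) xs → filterᵇ p xs ≡ []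
  filterᵇ-none [] = refl
  filterᵇ-none {p} {x ∷ _} (e ∷ es) with p x | e
  ... | false | refl = filterᵇ-none es

  length-filterᵇ-flip : {f g : A → Bool} {x₀ : A} {xs : List A} → Unique xs → x₀ ∈ xs →
                        (∀ x → x ≢ x₀ → f x ≡ g x) → f x₀ ≡ true → g x₀ ≡ false →
                        length (filterᵇ f xs) ≡ suc (length (filterᵇ g xs))
  length-filterᵇ-flip {f} {g} {xs = x ∷ _} (x∉xs ∷ _) (here refl) agree fx gx with f x | g x | fx | gx
  ... | true | false | refl | refl = cong (suc ∘ length) (filterᵇ-cong (All.map (λ {y} x≢y → agree y (x≢y ∘ sym)) x∉xs))
  length-filterᵇ-flip {f} {g} {xs = x ∷ _} (x∉xs ∷ uniq) (there x₀∈xs) agree fx gx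
    with f x | g x | agree x (lookup x∉xs x₀∈xs)
  ... | true  | true  | refl = cong suc (length-filterᵇ-flip uniq x₀∈xs agree fx gx)
  ... | false | false | refl = length-filterᵇ-flip uniq x₀∈xs agree fx gx

positionPairs : (n : ℕ) → List (Fin n × Fin n)
positionPairs n = concatMap (λ i → map (λ j → (i , j)) (allFin n)) (allFin n)

-- Defs.len w is, by definition, length (filterᵇ (isInversion w) (positionPairs n)).
isInversion : ∀ {n} → Perm n → Fin n × Fin n → Bool
isInversion w (i , j) = (i <ꟳ j) ∧ ((w ⟨$⟩ʳ j) <ꟳ (w ⟨$⟩ʳ i))

module _ {n : ℕ} where

  positionPairs≡cartesianProduct : positionPairs n ≡ cartesianProduct (allFin n) (allFin n)
  positionPairs≡cartesianProduct = go (allFin n)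
    where
    go : ∀ is → concatMap (λ i → map (λ j → (i , j)) (allFin n)) is ≡ cartesianProduct is (allFin n)
    go []       = refl
    go (i ∷ is) = cong (map (i ,_) (allFin n) ++_) (go is)

  positionPairs-unique : Unique (positionPairs n)
  positionPairs-unique rewrite positionPairs≡cartesianProduct = cartesianProduct⁺ (allFin⁺ n) (allFin⁺ n)

  ∈-positionPairs : ∀ (i j : Fin n) → (i , j) ∈ positionPairs n
  ∈-positionPairs i j rewrite positionPairs≡cartesianProduct = ∈-cartesianProduct⁺ (∈-allFin i) (∈-allFin j)

module _ {k : ℕ} where

  σ : Fin k → Fin (suc k) → Fin (suc k)
  σ a x = sgen a ⟨$⟩ʳ x

  σ-inject₁ : ∀ a → σ a (inject₁ a) ≡ suc a
  σ-inject₁ a = transpose-matchˡ (inject₁ a) (suc a)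

  σ-suc : ∀ a → σ a (suc a) ≡ inject₁ a
  σ-suc a = transpose-matchʳ (inject₁ a) (suc a)

  σ-other : ∀ a x → x ≢ inject₁ a → x ≢ suc a → σ a x ≡ x
  σ-other a x = transpose-mismatch (inject₁ a) (suc a) x

  σ-involutive : ∀ a x → σ a (σ a x) ≡ x
  σ-involutive a = transpose-involutive (inject₁ a) (suc a)

  sgen-·-involutive : ∀ a (u : Perm (suc k)) → sgen a · (sgen a · u) ≈ u
  sgen-·-involutive a = transpose-·-involutive (inject₁ a) (suc a)

  pos-sgen-· : ∀ a (u : Perm (suc k)) x → pos (sgen a · u) x ≡ pos u (σ a x)
  pos-sgen-· a u x = cong (u ⟨$⟩ˡ_) (sym (transpose-comm (inject₁ a) (suc a) x))

  inject₁<suc : ∀ (a : Fin k) → toℕ (inject₁ a) < toℕ (suc a)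
  inject₁<suc a rewrite toℕ-inject₁ a = n<1+n (toℕ a)

  inject₁≢suc : ∀ (a : Fin k) → inject₁ a ≢ suc a
  inject₁≢suc a = <⇒≢ (inject₁<suc a) ∘ cong toℕ

  σ-<ꟳ : ∀ a x y → x ≢ y → ¬ (x ≡ suc a × y ≡ inject₁ a) → ¬ (x ≡ inject₁ a × y ≡ suc a) →
         (σ a y <ꟳ σ a x) ≡ (y <ꟳ x)
  σ-<ꟳ a x y x≢y ¬ba ¬ab = by-cases (x ≟ inject₁ a) (x ≟ suc a) (y ≟ inject₁ a) (y ≟ suc a)
    where
    ≢a : ∀ {z} → z ≢ inject₁ a → toℕ z ≢ toℕ a
    ≢a z≢a e = z≢a (toℕ-injective (trans e (sym (toℕ-inject₁ a))))
    ≢1+a : ∀ {z} → z ≢ suc a → toℕ z ≢ suc (toℕ a)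
    ≢1+a z≢1+a = z≢1+a ∘ toℕ-injective
    by-cases : Dec (x ≡ inject₁ a) → Dec (x ≡ suc a) → Dec (y ≡ inject₁ a) → Dec (y ≡ suc a) →
               (σ a y <ꟳ σ a x) ≡ (y <ꟳ x)
    by-cases (yes refl) _ (yes y≡x) _ = ⊥-elim (x≢y (sym y≡x))
    by-cases (yes refl) _ (no _) (yes y≡1+a) = ⊥-elim (¬ab (refl , y≡1+a))
    by-cases (yes refl) _ (no y≢a) (no y≢1+a)
      rewrite σ-inject₁ a | σ-other a y y≢a y≢1+a | toℕ-inject₁ a = <ᵇ-suc≡<ᵇ (toℕ y) (toℕ a) (≢a y≢a)
    by-cases (no _) (yes refl) (yes y≡a) _ = ⊥-elim (¬ba (refl , y≡a))
    by-cases (no _) (yes refl) (no _) (yes y≡x) = ⊥-elim (x≢y (sym y≡x))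
    by-cases (no _) (yes refl) (no y≢a) (no y≢1+a)
      rewrite σ-suc a | σ-other a y y≢a y≢1+a | toℕ-inject₁ a = sym (<ᵇ-suc≡<ᵇ (toℕ y) (toℕ a) (≢a y≢a))
    by-cases (no x≢a) (no x≢1+a) (yes refl) _
      rewrite σ-inject₁ a | σ-other a x x≢a x≢1+a | toℕ-inject₁ a = suc-<ᵇ≡<ᵇ (toℕ x) (toℕ a) (≢1+a x≢1+a)
    by-cases (no x≢a) (no x≢1+a) (no _) (yes refl)
      rewrite σ-suc a | σ-other a x x≢a x≢1+a | toℕ-inject₁ a = sym (suc-<ᵇ≡<ᵇ (toℕ x) (toℕ a) (≢1+a x≢1+a))
    by-cases (no x≢a) (no x≢1+a) (no y≢a) (no y≢1+a)
      rewrite σ-other a x x≢a x≢1+a | σ-other a y y≢a y≢1+a = refl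

  Descent : Perm (suc k) → Fin k → Set
  Descent u a = toℕ (pos u (suc a)) < toℕ (pos u (inject₁ a))

  descent? : ∀ u a → Dec (Descent u a)
  descent? u a = toℕ (pos u (suc a)) <? toℕ (pos u (inject₁ a))

  pos-toℕ-injective : ∀ (u : Perm (suc k)) {x y} → x ≢ y → toℕ (pos u x) ≢ toℕ (pos u y)
  pos-toℕ-injective u x≢y = x≢y ∘ ⟨$⟩ˡ-injective u ∘ toℕ-injective

  ¬descent⇒< : ∀ u a → ¬ Descent u a → toℕ (pos u (inject₁ a)) < toℕ (pos u (suc a))
  ¬descent⇒< u a ¬d = ≤∧≢⇒< (≮⇒≥ ¬d) (pos-toℕ-injective u (inject₁≢suc a))

  ¬descent⇒descent-sgen-· : ∀ u a → ¬ Descent u a → Descent (sgen a · u) a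
  ¬descent⇒descent-sgen-· u a ¬d rewrite pos-sgen-· a u (suc a) | pos-sgen-· a u (inject₁ a) | σ-inject₁ a | σ-suc a =
    ¬descent⇒< u a ¬d

  descent⇒¬descent-sgen-· : ∀ u a → Descent u a → ¬ Descent (sgen a · u) a
  descent⇒¬descent-sgen-· u a d rewrite pos-sgen-· a u (suc a) | pos-sgen-· a u (inject₁ a) | σ-inject₁ a | σ-suc a =
    <-asym d

  -- s_a u has the same inversions as u, except the pair of positions of a+1 and a.
  len-descent : ∀ u a → Descent u a → len u ≡ suc (len (sgen a · u))
  len-descent u a d =
    length-filterᵇ-flip positionPairs-unique (∈-positionPairs (pos u (suc a)) (pos u (inject₁ a)))
      agree inversion-in-u no-inversion-in-su
    where
    su = sgen a · u
    inversion-in-u : isInversion u (pos u (suc a) , pos u (inject₁ a)) ≡ true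
    inversion-in-u rewrite inverseʳ u {inject₁ a} | inverseʳ u {suc a} | <⇒<ᵇ≡true d =
      <⇒<ᵇ≡true (inject₁<suc a)
    no-inversion-in-su : isInversion su (pos u (suc a) , pos u (inject₁ a)) ≡ false
    no-inversion-in-su rewrite inverseʳ u {inject₁ a} | inverseʳ u {suc a} | σ-inject₁ a | σ-suc a | <⇒<ᵇ≡true d =
      ≮⇒<ᵇ≡false (<-asym (inject₁<suc a))
    agree : ∀ ij → ij ≢ (pos u (suc a) , pos u (inject₁ a)) → isInversion u ij ≡ isInversion su ij
    agree (i , j) ij≢ with i <ꟳ j in i<j
    ... | false = refl
    ... | true  = sym (σ-<ꟳ a (u ⟨$⟩ʳ i) (u ⟨$⟩ʳ j) ui≢uj ¬ba ¬ab)
      where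
      pos-ui : ∀ {x} → u ⟨$⟩ʳ i ≡ x → i ≡ pos u x
      pos-ui refl = sym (inverseˡ u)
      pos-uj : ∀ {x} → u ⟨$⟩ʳ j ≡ x → j ≡ pos u x
      pos-uj refl = sym (inverseˡ u)
      ui≢uj : u ⟨$⟩ʳ i ≢ u ⟨$⟩ʳ j
      ui≢uj e = <⇒≢ (<ᵇ≡true⇒< i<j) (cong toℕ (⟨$⟩ʳ-injective u e))
      ¬ba : ¬ (u ⟨$⟩ʳ i ≡ suc a × u ⟨$⟩ʳ j ≡ inject₁ a)
      ¬ba (ui , uj) = ij≢ (cong₂ _,_ (pos-ui ui) (pos-uj uj))
      ¬ab : ¬ (u ⟨$⟩ʳ i ≡ inject₁ a × u ⟨$⟩ʳ j ≡ suc a)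
      ¬ab (ui , uj) = <-asym d (subst₂ (λ x y → toℕ x < toℕ y) (pos-ui ui) (pos-uj uj) (<ᵇ≡true⇒< i<j))

  len-cong : ∀ {u v : Perm (suc k)} → u ≈ v → len u ≡ len v
  len-cong {u} {v} p = cong length (filterᵇ-cong {f = isInversion u} {isInversion v} {positionPairs (suc k)}
    (All.tabulate λ { {i , j} _ → cong₂ (λ x y → (i <ꟳ j) ∧ (y <ꟳ x)) (p i) (p j) }))

  len-ascent : ∀ u a → ¬ Descent u a → len (sgen a · u) ≡ suc (len u)
  len-ascent u a ¬d =
    trans (len-descent (sgen a · u) a (¬descent⇒descent-sgen-· u a ¬d))
          (cong suc (len-cong {sgen a · (sgen a · u)} {u} (sgen-·-involutive a u)))

  sStar-descent : ∀ u a → Descent u a → sStar a u ≡ u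
  sStar-descent u a d rewrite len-descent u a d | <⇒<ᵇ≡true (n<1+n (len (sgen a · u))) = refl

  sStar-ascent : ∀ u a → ¬ Descent u a → sStar a u ≡ sgen a · u
  sStar-ascent u a ¬d rewrite len-ascent u a ¬d | ≮⇒<ᵇ≡false (<-asym (n<1+n (len u))) = refl

  descent-cong : ∀ {u v : Perm (suc k)} → u ≈ v → ∀ a → Descent u a → Descent v a
  descent-cong {u} {v} p a =
    subst₂ (λ x y → toℕ x < toℕ y) (pos-cong {u = u} {v} p (suc a)) (pos-cong {u = u} {v} p (inject₁ a))

  sStar-cong : ∀ a {u v : Perm (suc k)} → u ≈ v → sStar a u ≈ sStar a v
  sStar-cong a {u} {v} p with descent? u a
  ... | yes d rewrite sStar-descent u a d | sStar-descent v a (descent-cong {u} {v} p a d) = p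
  ... | no ¬d rewrite sStar-ascent u a ¬d | sStar-ascent v a (¬d ∘ descent-cong {v} {u} (λ i → sym (p i)) a) =
    ·-congˡ (sgen a) {u} {v} p

  len-id : len (id {suc k}) ≡ 0
  len-id = cong length (filterᵇ-none {p = isInversion id} {positionPairs (suc k)}
    (All.tabulate λ { {i , j} _ → no-inversion i j }))
    where
    no-inversion : ∀ i j → isInversion id (i , j) ≡ false
    no-inversion i j with i <ꟳ j in i<j
    ... | true  = ≮⇒<ᵇ≡false {toℕ j} {toℕ i} (<-asym (<ᵇ≡true⇒< i<j))
    ... | false = refl

  len-sgen-·-≤ : ∀ (u : Perm (suc k)) a → len (sgen a · u) ≤ suc (len u)
  len-sgen-·-≤ u a with descent? u a
  ... | yes d rewrite len-descent u a d = ≤-trans (n≤1+n _) (n≤1+n _)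
  ... | no ¬d = ≤-reflexive (len-ascent u a ¬d)

  len-wordProd-≤ : ∀ (as : List (Fin k)) → len (wordProd as) ≤ length as
  len-wordProd-≤ []       = ≤-reflexive len-id
  len-wordProd-≤ (a ∷ as) = ≤-trans (len-sgen-·-≤ (wordProd as) a) (s≤s (len-wordProd-≤ as))

-- Reduced words

module _ {n : ℕ} where

  increasing⇒≥ : (f : Fin n → Fin n) → (∀ {x y} → toℕ x < toℕ y → toℕ (f x) < toℕ (f y)) →
                 ∀ x → toℕ x ≤ toℕ (f x)
  increasing⇒≥ f increasing x = go (toℕ x) x refl
    where
    go : ∀ m x → toℕ x ≡ m → toℕ x ≤ toℕ (f x)
    go _       zero    _ = z≤n
    go zero    (suc y) ()
    go (suc m) (suc y) e =
      <-≤-trans (s≤s (subst (_≤ toℕ (f (inject₁ y))) (toℕ-inject₁ y) (go m (inject₁ y) y≡m)))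
                (increasing (subst (_< suc (toℕ y)) (sym (toℕ-inject₁ y)) (n<1+n (toℕ y))))
      where
      y≡m : toℕ (inject₁ y) ≡ m
      y≡m = trans (toℕ-inject₁ y) (suc-injective e)

  pos-increasing⇒≈id : (u : Perm n) → (∀ {x y} → toℕ x < toℕ y → toℕ (pos u x) < toℕ (pos u y)) → u ≈ id
  pos-increasing⇒≈id u pos-increasing x =
    toℕ-injective (≤-antisym
      (subst (λ z → toℕ (u ⟨$⟩ʳ x) ≤ toℕ z) (inverseˡ u) (increasing⇒≥ (pos u) pos-increasing (u ⟨$⟩ʳ x)))
      (increasing⇒≥ (u ⟨$⟩ʳ_) u-increasing x))
    where
    u-increasing : ∀ {x y} → toℕ x < toℕ y → toℕ (u ⟨$⟩ʳ x) < toℕ (u ⟨$⟩ʳ y)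
    u-increasing {x} {y} x<y with <-cmp (toℕ (u ⟨$⟩ʳ x)) (toℕ (u ⟨$⟩ʳ y))
    ... | tri< ux<uy _ _ = ux<uy
    ... | tri≈ _ ux≡uy _ = contradiction (cong toℕ (⟨$⟩ʳ-injective u (toℕ-injective ux≡uy))) (<⇒≢ x<y)
    ... | tri> _ _ uy<ux =
      contradiction (subst₂ (λ a b → toℕ a < toℕ b) (inverseˡ u) (inverseˡ u) (pos-increasing uy<ux)) (<-asym x<y)

module _ {k : ℕ} where

  NoDescentFrom : ℕ → Perm (suc k) → Set
  NoDescentFrom D u = ∀ (b : Fin k) → D ≤ toℕ b → ¬ Descent u b

  pos-increasing-from : ∀ {D u} → NoDescentFrom D u →
                        ∀ {x y} → D ≤ toℕ x → toℕ x < toℕ y → toℕ (pos u x) < toℕ (pos u y)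
  pos-increasing-from {D} {u} above {x} {y} D≤x x<y = go (toℕ y) y refl x<y
    where
    go : ∀ m y → toℕ y ≡ m → toℕ x < toℕ y → toℕ (pos u x) < toℕ (pos u y)
    go _       zero    _ ()
    go zero    (suc _) ()
    go (suc m) (suc b) e (s≤s x≤b) with toℕ x ℕ.≟ toℕ b
    ... | yes x≡b = subst (λ z → toℕ (pos u z) < toℕ (pos u (suc b))) (sym x≡inject₁b) step
      where
      x≡inject₁b : x ≡ inject₁ b
      x≡inject₁b = toℕ-injective (trans x≡b (sym (toℕ-inject₁ b)))
      step = ¬descent⇒< u b (above b (subst (D ≤_) x≡b D≤x))
    ... | no x≢b = <-trans (go m (inject₁ b) (trans (toℕ-inject₁ b) (suc-injective e))
                                 (subst (toℕ x <_) (sym (toℕ-inject₁ b)) (≤∧≢⇒< x≤b x≢b)))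
                           (¬descent⇒< u b (above b (≤-trans D≤x x≤b)))

  noDescent⇒≈id : ∀ u → NoDescentFrom 0 u → u ≈ id
  noDescent⇒≈id u above = pos-increasing⇒≈id u (pos-increasing-from {u = u} above z≤n)

  ≈id⇒noDescent : ∀ {u} → u ≈ id → NoDescentFrom 0 u
  ≈id⇒noDescent {u} u≈id b _ d =
    <-asym (subst₂ (λ x y → toℕ x < toℕ y) (fixed (suc b)) (fixed (inject₁ b)) d) (inject₁<suc b)
    where
    fixed : ∀ x → pos u x ≡ x
    fixed = pos-cong {u = u} {id} u≈id

  data TopDescent (u : Perm (suc k)) : Set where
    top  : ∀ d → Descent u d → NoDescentFrom (suc (toℕ d)) u → TopDescent u
    none : NoDescentFrom 0 u → TopDescent u

  topDescent : ∀ u → TopDescent u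
  topDescent u = search k ≤-refl (λ b k≤b → contradiction (<-≤-trans (toℕ<n b) k≤b) (<-irrefl refl))
    where
    search : ∀ m → m ≤ k → NoDescentFrom m u → TopDescent u
    search zero    _   above = none above
    search (suc m) m<k above with descent? u (fromℕ< m<k)
    ... | yes d  = top (fromℕ< m<k) d (λ b m<b → above b (subst (λ z → suc z ≤ toℕ b) (toℕ-fromℕ< m<k) m<b))
    ... | no  ¬d = search m (<⇒≤ m<k) above′
      where
      above′ : NoDescentFrom m u
      above′ b m≤b with toℕ b ℕ.≟ m
      ... | yes b≡m = subst (λ z → ¬ Descent u z) (toℕ-injective (trans (toℕ-fromℕ< m<k) (sym b≡m))) ¬d
      ... | no b≢m  = above b (≤∧≢⇒< m≤b (b≢m ∘ sym))

  reducedWord-cong : ∀ {u v : Perm (suc k)} {α} → u ≈ v → IsReducedWord u α → IsReducedWord v α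
  reducedWord-cong {u} {v} u≈v (eq , ℓ≡) = (λ i → trans (eq i) (u≈v i)) , trans ℓ≡ (len-cong {u = u} {v} u≈v)

  reducedWord-∷⁺ : ∀ {w : Perm (suc k)} {a α} → Descent w a → IsReducedWord (sgen a · w) α → IsReducedWord w (a ∷ α)
  reducedWord-∷⁺ {w} {a} d (eq , ℓ≡) =
    (λ i → trans (cong (σ a) (eq i)) (σ-involutive a (w ⟨$⟩ʳ i))) , trans (cong suc ℓ≡) (sym (len-descent w a d))

  wordProd-∷⁻ : ∀ {w : Perm (suc k)} {a α} → wordProd (a ∷ α) ≈ w → wordProd α ≈ sgen a · w
  wordProd-∷⁻ {w} {a} {α} eq i = trans (sym (σ-involutive a (wordProd α ⟨$⟩ʳ i))) (cong (σ a) (eq i))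

  reducedWord-∷⁻ : ∀ {w : Perm (suc k)} {a α} → IsReducedWord w (a ∷ α) → Descent w a × IsReducedWord (sgen a · w) α
  reducedWord-∷⁻ {w} {a} {α} (eq , ℓ≡) with descent? w a
  ... | yes d  = d , wordProd-∷⁻ {w} {a} {α} eq , suc-injective (trans ℓ≡ (len-descent w a d))
  ... | no  ¬d = contradiction (len-wordProd-≤ α) (<⇒≱ (subst (length α <_) (sym len-α) (s≤s (n≤1+n (length α)))))
    where
    len-α : len (wordProd α) ≡ suc (suc (length α))
    len-α = trans (len-cong {u = wordProd α} {sgen a · w} (wordProd-∷⁻ {w} {a} {α} eq))
                  (trans (len-ascent w a ¬d) (cong suc (sym ℓ≡)))

  reducedWord-exists : ∀ u → Σ (List (Fin k)) (IsReducedWord u)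
  reducedWord-exists u = go (len u) u refl
    where
    go : ∀ m u → len u ≡ m → Σ (List (Fin k)) (IsReducedWord u)
    go m u ℓ≡ with topDescent u
    ... | none above =
      [] , (λ i → sym (noDescent⇒≈id u above i)) ,
      sym (trans (len-cong {u = u} {id} (noDescent⇒≈id u above)) (len-id {k}))
    go zero    u ℓ≡ | top d du _ = contradiction (trans (sym ℓ≡) (len-descent u d du)) λ ()
    go (suc m) u ℓ≡ | top d du _ with go m (sgen d · u) (suc-injective (trans (sym (len-descent u d du)) ℓ≡))
    ... | α , red = d ∷ α , reducedWord-∷⁺ {u} {d} {α} du red

-- Commutation and braid relations of ⋆

module _ {k : ℕ} where

  private
    P = Perm (suc k)

  Far : Fin k → Fin k → Set
  Far a b = suc (toℕ a) < toℕ b ⊎ suc (toℕ b) < toℕ a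

  far-sym : ∀ {a b : Fin k} → Far a b → Far b a
  far-sym (inj₁ a+1<b) = inj₂ a+1<b
  far-sym (inj₂ b+1<a) = inj₁ b+1<a

  far⇒σ-fixes : ∀ {a b : Fin k} → Far a b → σ b (inject₁ a) ≡ inject₁ a × σ b (suc a) ≡ suc a
  far⇒σ-fixes {a} {b} far =
    σ-other b (inject₁ a) (apart (inject₁ a) (inject₁ b) (lo far)) (apart (inject₁ a) (suc b) (lo-hi far)) ,
    σ-other b (suc a) (apart (suc a) (inject₁ b) (hi-lo far)) (apart (suc a) (suc b) (hi far))
    where
    apart : ∀ (x y : Fin (suc k)) → toℕ x < toℕ y ⊎ toℕ y < toℕ x → x ≢ y
    apart x y = [ Finₚ.<⇒≢ , >⇒≢ ]
    ta = toℕ-inject₁ a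
    tb = toℕ-inject₁ b
    lo : Far a b → toℕ (inject₁ a) < toℕ (inject₁ b) ⊎ toℕ (inject₁ b) < toℕ (inject₁ a)
    lo (inj₁ l) rewrite ta | tb = inj₁ (<-trans (n<1+n _) l)
    lo (inj₂ l) rewrite ta | tb = inj₂ (<-trans (n<1+n _) l)
    lo-hi : Far a b → toℕ (inject₁ a) < toℕ (suc b) ⊎ toℕ (suc b) < toℕ (inject₁ a)
    lo-hi (inj₁ l) rewrite ta = inj₁ (<-trans (<-trans (n<1+n _) l) (n<1+n _))
    lo-hi (inj₂ l) rewrite ta = inj₂ l
    hi-lo : Far a b → toℕ (suc a) < toℕ (inject₁ b) ⊎ toℕ (inject₁ b) < toℕ (suc a)
    hi-lo (inj₁ l) rewrite tb = inj₁ l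
    hi-lo (inj₂ l) rewrite tb = inj₂ (<-trans (<-trans (n<1+n _) l) (n<1+n _))
    hi : Far a b → toℕ (suc a) < toℕ (suc b) ⊎ toℕ (suc b) < toℕ (suc a)
    hi (inj₁ l) = inj₁ (<-trans l (n<1+n _))
    hi (inj₂ l) = inj₂ (<-trans l (n<1+n _))

  descent-far⁺ : ∀ {a b : Fin k} → Far a b → ∀ (u : P) → Descent u a → Descent (sgen b · u) a
  descent-far⁺ {a} {b} far u
    rewrite pos-sgen-· b u (suc a) | pos-sgen-· b u (inject₁ a) | proj₁ (far⇒σ-fixes far) | proj₂ (far⇒σ-fixes far) =
      λ d → d

  descent-far⁻ : ∀ {a b : Fin k} → Far a b → ∀ (u : P) → Descent (sgen b · u) a → Descent u a
  descent-far⁻ {a} {b} far u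
    rewrite pos-sgen-· b u (suc a) | pos-sgen-· b u (inject₁ a) | proj₁ (far⇒σ-fixes far) | proj₂ (far⇒σ-fixes far) =
      λ d → d

  sgen-commute : ∀ {a b : Fin k} → Far a b → ∀ (u : P) → sgen a · (sgen b · u) ≈ sgen b · (sgen a · u)
  sgen-commute {a} {b} far u x =
    trans (sym (transpose-conjugate (sgen a) (inject₁ b) (suc b) (u ⟨$⟩ʳ x)))
          (cong₂ (λ i j → PC.transpose i j (σ a (u ⟨$⟩ʳ x)))
                 (proj₁ (far⇒σ-fixes (far-sym far))) (proj₂ (far⇒σ-fixes (far-sym far))))

  sStar-commute : ∀ {a b : Fin k} → Far a b → ∀ y → sStar a (sStar b y) ≈ sStar b (sStar a y)
  sStar-commute {a} {b} far y with descent? y a | descent? y b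
  ... | yes da | yes db rewrite sStar-descent y b db | sStar-descent y a da | sStar-descent y b db = λ _ → refl
  ... | yes da | no ¬db
    rewrite sStar-ascent y b ¬db | sStar-descent y a da
          | sStar-descent (sgen b · y) a (descent-far⁺ far y da) | sStar-ascent y b ¬db = λ _ → refl
  ... | no ¬da | yes db
    rewrite sStar-descent y b db | sStar-ascent y a ¬da
          | sStar-descent (sgen a · y) b (descent-far⁺ (far-sym far) y db) = λ _ → refl
  ... | no ¬da | no ¬db
    rewrite sStar-ascent y b ¬db | sStar-ascent y a ¬da
          | sStar-ascent (sgen b · y) a (¬da ∘ descent-far⁻ far y)
          | sStar-ascent (sgen a · y) b (¬db ∘ descent-far⁻ (far-sym far) y) = sgen-commute far y

  module Braid (a d : Fin k) (d≡1+a : toℕ d ≡ suc (toℕ a)) where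

    suc-a≡inject₁-d : suc a ≡ inject₁ d
    suc-a≡inject₁-d = toℕ-injective (trans (sym d≡1+a) (sym (toℕ-inject₁ d)))

    p₀ p₁ p₂ : P → ℕ
    p₀ u = toℕ (pos u (inject₁ a))
    p₁ u = toℕ (pos u (suc a))
    p₂ u = toℕ (pos u (suc d))

    private
      a<a+2 : toℕ (inject₁ a) < toℕ (suc d)
      a<a+2 rewrite toℕ-inject₁ a | d≡1+a = <-trans (n<1+n _) (n<1+n _)
      a+1<a+2 : toℕ (suc a) < toℕ (suc d)
      a+1<a+2 rewrite d≡1+a = n<1+n _

      σa-suc-d : σ a (suc d) ≡ suc d
      σa-suc-d = σ-other a (suc d) (>⇒≢ a<a+2) (>⇒≢ a+1<a+2)
      σd-inject₁-a : σ d (inject₁ a) ≡ inject₁ a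
      σd-inject₁-a = σ-other d (inject₁ a) (λ e → inject₁≢suc a (trans e (sym suc-a≡inject₁-d))) (Finₚ.<⇒≢ a<a+2)
      σd-suc-a : σ d (suc a) ≡ suc d
      σd-suc-a = trans (cong (σ d) suc-a≡inject₁-d) (σ-inject₁ d)
      σd-suc-d : σ d (suc d) ≡ suc a
      σd-suc-d = trans (σ-suc d) (sym suc-a≡inject₁-d)

    p₀-sa : ∀ u → p₀ (sgen a · u) ≡ p₁ u
    p₀-sa u = cong toℕ (trans (pos-sgen-· a u (inject₁ a)) (cong (pos u) (σ-inject₁ a)))
    p₁-sa : ∀ u → p₁ (sgen a · u) ≡ p₀ u
    p₁-sa u = cong toℕ (trans (pos-sgen-· a u (suc a)) (cong (pos u) (σ-suc a)))
    p₂-sa : ∀ u → p₂ (sgen a · u) ≡ p₂ u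
    p₂-sa u = cong toℕ (trans (pos-sgen-· a u (suc d)) (cong (pos u) σa-suc-d))
    p₀-sd : ∀ u → p₀ (sgen d · u) ≡ p₀ u
    p₀-sd u = cong toℕ (trans (pos-sgen-· d u (inject₁ a)) (cong (pos u) σd-inject₁-a))
    p₁-sd : ∀ u → p₁ (sgen d · u) ≡ p₂ u
    p₁-sd u = cong toℕ (trans (pos-sgen-· d u (suc a)) (cong (pos u) σd-suc-a))
    p₂-sd : ∀ u → p₂ (sgen d · u) ≡ p₁ u
    p₂-sd u = cong toℕ (trans (pos-sgen-· d u (suc d)) (cong (pos u) σd-suc-d))

    descent-d⁺ : ∀ u → p₂ u < p₁ u → Descent u d
    descent-d⁺ u = subst (λ x → p₂ u < toℕ (pos u x)) suc-a≡inject₁-d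

    descent-d⁻ : ∀ u → Descent u d → p₂ u < p₁ u
    descent-d⁻ u = subst (λ x → p₂ u < toℕ (pos u x)) (sym suc-a≡inject₁-d)

    ⋆a-keep : ∀ u {m n} → p₁ u ≡ m → p₀ u ≡ n → m < n → sStar a u ≡ u
    ⋆a-keep u refl refl = sStar-descent u a
    ⋆a-move : ∀ u {m n} → p₀ u ≡ m → p₁ u ≡ n → m < n → sStar a u ≡ sgen a · u
    ⋆a-move u refl refl p₀<p₁ = sStar-ascent u a (<-asym p₀<p₁)
    ⋆d-keep : ∀ u {m n} → p₂ u ≡ m → p₁ u ≡ n → m < n → sStar d u ≡ u
    ⋆d-keep u refl refl p₂<p₁ = sStar-descent u d (descent-d⁺ u p₂<p₁)
    ⋆d-move : ∀ u {m n} → p₁ u ≡ m → p₂ u ≡ n → m < n → sStar d u ≡ sgen d · u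
    ⋆d-move u refl refl p₁<p₂ = sStar-ascent u d (<-asym p₁<p₂ ∘ descent-d⁻ u)

    braid : ∀ u → sgen a · (sgen d · (sgen a · u)) ≈ sgen d · (sgen a · (sgen d · u))
    braid u x = trans via-a (sym via-d)
      where
      y = u ⟨$⟩ʳ x
      cong₃ : ∀ {A B C D : Set} (f : A → B → C → D) {a a′ b b′ c c′} → a ≡ a′ → b ≡ b′ → c ≡ c′ → f a b c ≡ f a′ b′ c′
      cong₃ f refl refl refl = refl
      via-a : σ a (σ d (σ a y)) ≡ PC.transpose (inject₁ a) (suc d) y
      via-a = trans (sym (transpose-conjugate (sgen a) (inject₁ d) (suc d) (σ a y)))
                    (cong₃ PC.transpose (trans (cong (σ a) (sym suc-a≡inject₁-d)) (σ-suc a)) σa-suc-d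
                                        (σ-involutive a y))
      via-d : σ d (σ a (σ d y)) ≡ PC.transpose (inject₁ a) (suc d) y
      via-d = trans (sym (transpose-conjugate (sgen d) (inject₁ a) (suc a) (σ d y)))
                    (cong₃ PC.transpose σd-inject₁-a σd-suc-a (σ-involutive d y))

    sStar-braid : ∀ y → sStar a (sStar d (sStar a y)) ≈ sStar d (sStar a (sStar d y))
    sStar-braid y = by-order (compare (inject₁≢suc a)) (compare (Finₚ.<⇒≢ a+1<a+2)) (compare (Finₚ.<⇒≢ a<a+2))
      where
      compare : ∀ {x x′} → x ≢ x′ → toℕ (pos y x) < toℕ (pos y x′) ⊎ toℕ (pos y x′) < toℕ (pos y x)
      compare {x} {x′} x≢x′ with <-cmp (toℕ (pos y x)) (toℕ (pos y x′))
      ... | tri< lt _ _ = inj₁ lt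
      ... | tri≈ _ eq _ = contradiction eq (pos-toℕ-injective y x≢x′)
      ... | tri> _ _ gt = inj₂ gt
      sa sd : P → P
      sa u = sgen a · u
      sd u = sgen d · u
      chain : ∀ b c e {y₁ y₂ y₃} → sStar e y ≡ y₁ → sStar c y₁ ≡ y₂ → sStar b y₂ ≡ y₃ →
              sStar b (sStar c (sStar e y)) ≡ y₃
      chain b c e step₁ step₂ step₃ = trans (cong (sStar b ∘ sStar c) step₁) (trans (cong (sStar b) step₂) step₃)
      both : ∀ {z} → sStar a (sStar d (sStar a y)) ≡ z → sStar d (sStar a (sStar d y)) ≡ z →
             sStar a (sStar d (sStar a y)) ≈ sStar d (sStar a (sStar d y))
      both l r = ≡⇒≈ (trans l (sym r))
      by-order : p₀ y < p₁ y ⊎ p₁ y < p₀ y → p₁ y < p₂ y ⊎ p₂ y < p₁ y → p₀ y < p₂ y ⊎ p₂ y < p₀ y →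
                 sStar a (sStar d (sStar a y)) ≈ sStar d (sStar a (sStar d y))
      by-order (inj₁ h01) (inj₁ h12) (inj₁ h02) =
        λ i → trans (cong (_⟨$⟩ʳ i) l) (trans (braid y i) (cong (_⟨$⟩ʳ i) (sym r)))
        where
        l = chain a d a (⋆a-move y refl refl h01) (⋆d-move (sa y) (p₁-sa y) (p₂-sa y) h02)
                        (⋆a-move (sd (sa y)) (trans (p₀-sd (sa y)) (p₀-sa y)) (trans (p₁-sd (sa y)) (p₂-sa y)) h12)
        r = chain d a d (⋆d-move y refl refl h12) (⋆a-move (sd y) (p₀-sd y) (p₁-sd y) h02)
                        (⋆d-move (sa (sd y)) (trans (p₁-sa (sd y)) (p₀-sd y)) (trans (p₂-sa (sd y)) (p₂-sd y)) h01)
      by-order (inj₁ h01) (inj₁ h12) (inj₂ h20) = contradiction (<-trans h01 h12) (<-asym h20)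
      by-order (inj₁ h01) (inj₂ h21) (inj₁ h02) = both
        (chain a d a (⋆a-move y refl refl h01) (⋆d-move (sa y) (p₁-sa y) (p₂-sa y) h02)
                     (⋆a-keep (sd (sa y)) (trans (p₁-sd (sa y)) (p₂-sa y)) (trans (p₀-sd (sa y)) (p₀-sa y)) h21))
        (chain d a d (⋆d-keep y refl refl h21) (⋆a-move y refl refl h01) (⋆d-move (sa y) (p₁-sa y) (p₂-sa y) h02))
      by-order (inj₁ h01) (inj₂ h21) (inj₂ h20) = both
        (chain a d a (⋆a-move y refl refl h01) (⋆d-keep (sa y) (p₂-sa y) (p₁-sa y) h20)
                     (⋆a-keep (sa y) (p₁-sa y) (p₀-sa y) h01))
        (chain d a d (⋆d-keep y refl refl h21) (⋆a-move y refl refl h01) (⋆d-keep (sa y) (p₂-sa y) (p₁-sa y) h20))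
      by-order (inj₂ h10) (inj₁ h12) (inj₁ h02) = both
        (chain a d a (⋆a-keep y refl refl h10) (⋆d-move y refl refl h12) (⋆a-move (sd y) (p₀-sd y) (p₁-sd y) h02))
        (chain d a d (⋆d-move y refl refl h12) (⋆a-move (sd y) (p₀-sd y) (p₁-sd y) h02)
                     (⋆d-keep (sa (sd y)) (trans (p₂-sa (sd y)) (p₂-sd y)) (trans (p₁-sa (sd y)) (p₀-sd y)) h10))
      by-order (inj₂ h10) (inj₁ h12) (inj₂ h20) = both
        (chain a d a (⋆a-keep y refl refl h10) (⋆d-move y refl refl h12) (⋆a-keep (sd y) (p₁-sd y) (p₀-sd y) h20))
        (chain d a d (⋆d-move y refl refl h12) (⋆a-keep (sd y) (p₁-sd y) (p₀-sd y) h20)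
                     (⋆d-keep (sd y) (p₂-sd y) (p₁-sd y) h12))
      by-order (inj₂ h10) (inj₂ h21) (inj₁ h02) = contradiction (<-trans h21 h10) (<-asym h02)
      by-order (inj₂ h10) (inj₂ h21) (inj₂ h20) = both
        (chain a d a (⋆a-keep y refl refl h10) (⋆d-keep y refl refl h21) (⋆a-keep y refl refl h10))
        (chain d a d (⋆d-keep y refl refl h21) (⋆a-keep y refl refl h10) (⋆d-keep y refl refl h21))

    descents-after-sa : ∀ u → Descent u a → Descent u d → Descent (sgen a · u) d × Descent (sgen d · (sgen a · u)) a
    descents-after-sa u p₁<p₀ dd =
      descent-d⁺ (sgen a · u) (subst₂ _<_ (sym (p₂-sa u)) (sym (p₁-sa u)) (<-trans p₂<p₁ p₁<p₀)) ,
      subst₂ _<_ (sym (trans (p₁-sd (sgen a · u)) (p₂-sa u))) (sym (trans (p₀-sd (sgen a · u)) (p₀-sa u))) p₂<p₁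
      where p₂<p₁ = descent-d⁻ u dd

    descents-after-sd : ∀ u → Descent u a → Descent u d → Descent (sgen d · u) a × Descent (sgen a · (sgen d · u)) d
    descents-after-sd u p₁<p₀ dd =
      subst₂ _<_ (sym (p₁-sd u)) (sym (p₀-sd u)) (<-trans p₂<p₁ p₁<p₀) ,
      descent-d⁺ (sgen a · (sgen d · u))
        (subst₂ _<_ (sym (trans (p₂-sa (sgen d · u)) (p₂-sd u))) (sym (trans (p₁-sa (sgen d · u)) (p₀-sd u))) p₁<p₀)
      where p₂<p₁ = descent-d⁻ u dd

-- Hopping operators as products of conditional transpositions

iter-fixed : ∀ {A : Set} (f : A → A) {z} → f z ≡ z → ∀ j → iter j f z ≡ z
iter-fixed f fz≡z zero    = refl
iter-fixed f fz≡z (suc j) rewrite fz≡z = iter-fixed f fz≡z j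

iter-suc : ∀ {A : Set} (f : A → A) j z → iter (suc j) f z ≡ f (iter j f z)
iter-suc f zero    z = refl
iter-suc f (suc j) z = iter-suc f j (f z)

module _ {A : Set} (p : A → Bool) where

  lastSuch-∷ʳ : ∀ L ℓ → lastSuch p (L ∷ʳ ℓ) ≡ (if p ℓ then just ℓ else lastSuch p L)
  lastSuch-∷ʳ L ℓ rewrite reverse-++ L (ℓ ∷ []) = refl

  lastSuch-sound : ∀ L {q} → lastSuch p L ≡ just q → p q ≡ true
  lastSuch-sound L = find-sound (reverse L)
    where
    find-sound : ∀ xs {q} → findᵇ p xs ≡ just q → p q ≡ true
    find-sound (x ∷ xs) e with p x in px
    find-sound (x ∷ xs) refl | true  = px
    find-sound (x ∷ xs) e    | false = find-sound xs e

module Hopping {m : ℕ} (t : Fin (suc m)) where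

  private
    P = Perm (suc m)

  canHop : P → Fin (suc m) → Bool
  canHop z q = (t <ꟳ q) ∧ (pos z t <ꟳ pos z q)

  swapIf : Fin (suc m) → P → P
  swapIf q z = if canHop z q then transpose t q · z else z

  swapsAlong : List (Fin (suc m)) → P → P
  swapsAlong L x = foldr swapIf x L

  canHop⇒< : ∀ {z q} → canHop z q ≡ true → toℕ t < toℕ q × toℕ (pos z t) < toℕ (pos z q)
  canHop⇒< {z} {q} e with t <ꟳ q in t<q | pos z t <ꟳ pos z q in tq
  ... | true | true = <ᵇ≡true⇒< t<q , <ᵇ≡true⇒< tq

  cannotHop : ∀ {z q} → (toℕ t < toℕ q → ¬ toℕ (pos z t) < toℕ (pos z q)) → canHop z q ≡ false
  cannotHop {z} {q} h with t <ꟳ q in t<q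
  ... | false = refl
  ... | true  = ≮⇒<ᵇ≡false (h (<ᵇ≡true⇒< t<q))

  cannotHop⁻ : ∀ {z q} → canHop z q ≡ false → toℕ t < toℕ q → ¬ toℕ (pos z t) < toℕ (pos z q)
  cannotHop⁻ {z} {q} e t<q tq rewrite <⇒<ᵇ≡true t<q | <⇒<ᵇ≡true tq = contradiction e λ ()

  hopStep-defn : ∀ L z → hopStep t L z ≡ maybe′ (λ q → transpose t q · z) z (lastSuch (canHop z) L)
  hopStep-defn L z with lastSuch (canHop z) L
  ... | nothing = refl
  ... | just _  = refl

  hopStep-moves-t : ∀ L z → hopStep t L z ≡ z ⊎ toℕ (pos z t) < toℕ (pos (hopStep t L z) t)
  hopStep-moves-t L z with lastSuch (canHop z) L in found
  ... | nothing = inj₁ refl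
  ... | just q  = inj₂ (subst (λ y → toℕ (pos z t) < toℕ (pos z y)) (sym (transpose-matchʳ q t))
                              (proj₂ (canHop⇒< {z} {q} (lastSuch-sound (canHop z) L found))))

  -- t moves strictly right at every effective step, so m more steps reach a fixed point.
  iter-hopStep-fixed : ∀ L j z → m ≤ j + toℕ (pos z t) →
                       hopStep t L (iter j (hopStep t L) z) ≡ iter j (hopStep t L) z
  iter-hopStep-fixed L zero z m≤ with hopStep-moves-t L z
  ... | inj₁ fixed = fixed
  ... | inj₂ moved = contradiction (≤-pred (toℕ<n (pos (hopStep t L z) t))) (<⇒≱ (≤-<-trans m≤ moved))
  iter-hopStep-fixed L (suc j) z m≤ with hopStep-moves-t L z
  ... | inj₁ fixed = subst (λ y → hopStep t L (iter j (hopStep t L) y) ≡ iter j (hopStep t L) y) (sym fixed)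
                            (subst (λ y → hopStep t L y ≡ y) (sym (iter-fixed (hopStep t L) fixed j)) fixed)
  ... | inj₂ moved = iter-hopStep-fixed L j (hopStep t L z)
                       (≤-trans m≤ (subst (_≤ j + toℕ (pos (hopStep t L z) t)) (+-suc j (toℕ (pos z t)))
                                          (+-monoʳ-≤ j moved)))

  cannotHop-hopStep : ∀ L {z ℓ} → canHop z ℓ ≡ false → canHop (hopStep t L z) ℓ ≡ false
  cannotHop-hopStep L {z} {ℓ} stuck with lastSuch (canHop z) L in found
  ... | nothing = stuck
  ... | just q  = cannotHop {transpose t q · z} {ℓ} (λ t<ℓ → still-stuck t<ℓ (ℓ ≟ q))
    where
    tq : toℕ (pos z t) < toℕ (pos z q)
    tq = proj₂ (canHop⇒< {z} {q} (lastSuch-sound (canHop z) L found))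
    pos-t : pos (transpose t q · z) t ≡ pos z q
    pos-t = cong (pos z) (transpose-matchʳ q t)
    still-stuck : toℕ t < toℕ ℓ → Dec (ℓ ≡ q) → ¬ toℕ (pos (transpose t q · z) t) < toℕ (pos (transpose t q · z) ℓ)
    still-stuck t<ℓ (yes refl) rewrite pos-t | transpose-matchˡ ℓ t = <-asym tq
    still-stuck t<ℓ (no ℓ≢q) rewrite pos-t | transpose-mismatch q t ℓ ℓ≢q (>⇒≢ t<ℓ) =
      cannotHop⁻ {z} {ℓ} stuck t<ℓ ∘ <-trans tq

  hopStep-∷ʳ : ∀ L {ℓ z} → canHop z ℓ ≡ false → hopStep t (L ∷ʳ ℓ) z ≡ hopStep t L z
  hopStep-∷ʳ L {ℓ} {z} stuck
    rewrite hopStep-defn (L ∷ʳ ℓ) z | hopStep-defn L z | lastSuch-∷ʳ (canHop z) L ℓ | stuck = refl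

  iter-hopStep-∷ʳ : ∀ L {ℓ} j {z} → canHop z ℓ ≡ false → iter j (hopStep t (L ∷ʳ ℓ)) z ≡ iter j (hopStep t L) z
  iter-hopStep-∷ʳ L zero    stuck = refl
  iter-hopStep-∷ʳ L {ℓ} (suc j) stuck =
    trans (cong (iter j (hopStep t (L ∷ʳ ℓ))) (hopStep-∷ʳ L stuck)) (iter-hopStep-∷ʳ L j (cannotHop-hopStep L stuck))

  -- The last entry of the list is the first one to be tried, and once it has hopped it never can again.
  hop-∷ʳ : ∀ L ℓ x → hop t (L ∷ʳ ℓ) x ≡ hop t L (swapIf ℓ x)
  hop-∷ʳ L ℓ x with canHop x ℓ in can
  ... | false = iter-hopStep-∷ʳ L (suc m) can
  ... | true  = begin
    iter m (hopStep t (L ∷ʳ ℓ)) (hopStep t (L ∷ʳ ℓ) x) ≡⟨ cong (iter m (hopStep t (L ∷ʳ ℓ))) first-step ⟩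
    iter m (hopStep t (L ∷ʳ ℓ)) z                      ≡⟨ iter-hopStep-∷ʳ L m stuck ⟩
    iter m (hopStep t L) z                             ≡⟨ iter-hopStep-fixed L m z (m≤m+n m _) ⟨
    hopStep t L (iter m (hopStep t L) z)               ≡⟨ iter-suc (hopStep t L) m z ⟨
    hop t L z                                          ∎
    where
    open ≡-Reasoning
    z = transpose t ℓ · x
    first-step : hopStep t (L ∷ʳ ℓ) x ≡ z
    first-step rewrite hopStep-defn (L ∷ʳ ℓ) x | lastSuch-∷ʳ (canHop x) L ℓ | can = refl
    stuck : canHop z ℓ ≡ false
    stuck = cannotHop {z} {ℓ} λ _ → subst₂ (λ i j → ¬ toℕ (pos x i) < toℕ (pos x j))
                                           (sym (transpose-matchʳ ℓ t)) (sym (transpose-matchˡ ℓ t))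
                                           (<-asym (proj₂ (canHop⇒< {x} {ℓ} can)))

  hop≡swapsAlong : ∀ L x → hop t L x ≡ swapsAlong L x
  hop≡swapsAlong L = go (reverseView L)
    where
    go : ∀ {L} → Reverse L → ∀ x → hop t L x ≡ swapsAlong L x
    go []           x = iter-fixed (hopStep t []) refl (suc m)
    go (L ∶ r ∶ʳ ℓ) x = trans (hop-∷ʳ L ℓ x) (trans (go r (swapIf ℓ x)) (sym (foldr-∷ʳ swapIf x ℓ L)))

module _ {m : ℕ} where

  open Hopping using (canHop; swapIf; swapsAlong)

  private
    P = Perm (suc m)

  canHop-cong : ∀ t q {z z′ : P} → z ≈ z′ → canHop t z q ≡ canHop t z′ q
  canHop-cong t q {z} {z′} z≈z′ =
    cong₂ (λ i j → (t <ꟳ q) ∧ (i <ꟳ j)) (pos-cong {u = z} {z′} z≈z′ t) (pos-cong {u = z} {z′} z≈z′ q)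

  swapIf-cong : ∀ t q {z z′ : P} → z ≈ z′ → swapIf t q z ≈ swapIf t q z′
  swapIf-cong t q {z} {z′} z≈z′ rewrite canHop-cong t q {z} {z′} z≈z′ with canHop t z′ q
  ... | true  = ·-congˡ (transpose t q) {z} {z′} z≈z′
  ... | false = z≈z′

  swapsAlong-cong : ∀ t L {z z′ : P} → z ≈ z′ → swapsAlong t L z ≈ swapsAlong t L z′
  swapsAlong-cong t []      z≈z′ = z≈z′
  swapsAlong-cong t (q ∷ L) z≈z′ = swapIf-cong t q (swapsAlong-cong t L z≈z′)

  swapIf-relabel : (π : P) {t q : Fin (suc m)} → (t <ꟳ q) ≡ ((π ⟨$⟩ʳ t) <ꟳ (π ⟨$⟩ʳ q)) →
                   ∀ z → swapIf (π ⟨$⟩ʳ t) (π ⟨$⟩ʳ q) (π · z) ≈ π · swapIf t q z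
  swapIf-relabel π {t} {q} order z rewrite sym order | pos-· π z t | pos-· π z q with canHop t z q
  ... | true  = λ i → transpose-conjugate π t q (z ⟨$⟩ʳ i)
  ... | false = λ _ → refl

  swapsAlong-relabel : (π : P) {t t′ : Fin (suc m)} → π ⟨$⟩ʳ t ≡ t′ →
                       ∀ {L L′} → Pointwise (λ q q′ → π ⟨$⟩ʳ q ≡ q′ × (t <ꟳ q) ≡ (t′ <ꟳ q′)) L L′ →
                       ∀ z → swapsAlong t′ L′ (π · z) ≈ π · swapsAlong t L z
  swapsAlong-relabel π refl [] z _ = refl
  swapsAlong-relabel π {t} refl {q ∷ L} {_ ∷ L′} ((refl , order) ∷ pw) z i =
    trans (swapIf-cong (π ⟨$⟩ʳ t) (π ⟨$⟩ʳ q) (swapsAlong-relabel π refl pw z) i)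
          (swapIf-relabel π order (swapsAlong t L z) i)

-- The lists w↖t

module _ {A B : Set} where

  filterᵇ-map : (p : B → Bool) (f : A → B) → ∀ xs → filterᵇ p (map f xs) ≡ map f (filterᵇ (p ∘ f) xs)
  filterᵇ-map p f [] = refl
  filterᵇ-map p f (x ∷ xs) with p (f x)
  ... | true  = cong (f x ∷_) (filterᵇ-map p f xs)
  ... | false = filterᵇ-map p f xs

  filterᵇ-map-filterᵇ-none : {p : B → Bool} {f : A → B} {q : A → Bool} →
                             (∀ x → q x ≡ true → p (f x) ≡ false) → ∀ xs → filterᵇ p (map f (filterᵇ q xs)) ≡ []
  filterᵇ-map-filterᵇ-none h [] = refl
  filterᵇ-map-filterᵇ-none {p} {f} {q} h (x ∷ xs) with q x in qx
  ... | false = filterᵇ-map-filterᵇ-none h xs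
  ... | true rewrite h x qx = filterᵇ-map-filterᵇ-none h xs

  filterᵇ-map-cong : {p p′ : B → Bool} {f f′ : A → B} {xs : List A} →
                     All (λ x → f x ≡ f′ x × p (f x) ≡ p′ (f′ x)) xs → filterᵇ p (map f xs) ≡ filterᵇ p′ (map f′ xs)
  filterᵇ-map-cong [] = refl
  filterᵇ-map-cong {p} {p′} {f} {f′} {x ∷ _} ((fx , px) ∷ agree) with p (f x) | p′ (f′ x) | px
  ... | true  | true  | refl = cong₂ _∷_ fx (filterᵇ-map-cong agree)
  ... | false | false | refl = filterᵇ-map-cong agree

module _ {n : ℕ} {A : Set} (p p′ : A → Bool) (f f′ : Fin n → A) (c : Fin n) where

  filterᵇ-map-extra-head : ∀ {I} → AllPairs (λ i j → toℕ i < toℕ j) I → c ∈ I →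
    All (λ i → toℕ i < toℕ c → p (f i) ≡ false × p′ (f′ i) ≡ false) I →
    p (f c) ≡ true → p′ (f′ c) ≡ false →
    All (λ i → toℕ c < toℕ i → f i ≡ f′ i × p (f i) ≡ p′ (f′ i)) I →
    filterᵇ p (map f I) ≡ f c ∷ filterᵇ p′ (map f′ I)
  filterᵇ-map-extra-head {i ∷ _} (c<rest ∷ _) (here refl) _ keep drop (_ ∷ after)
    with p (f i) | p′ (f′ i) | keep | drop
  ... | true | false | refl | refl =
    cong (f i ∷_) (filterᵇ-map-cong (All.zipWith (λ (c<j , agree) → agree c<j) (c<rest , after)))
  filterᵇ-map-extra-head {i ∷ _} (i<rest ∷ sorted) (there c∈I) (skip ∷ before) keep drop (_ ∷ after)
    with p (f i) | p′ (f′ i) | skip (lookup i<rest c∈I)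
  ... | false | false | _ = filterᵇ-map-extra-head sorted c∈I before keep drop after

module _ {n : ℕ} where

  nwList-relabel : (π w : Perm n) (t : Fin n) → π ⟨$⟩ʳ t ≡ t → (∀ q → (t <ꟳ (π ⟨$⟩ʳ q)) ≡ (t <ꟳ q)) →
                   nwList (π · w) t ≡ map (π ⟨$⟩ʳ_) (nwList w t)
  nwList-relabel π w t πt≡t order = begin
    filterᵇ (t <ꟳ_) (map ((π · w) ⟨$⟩ʳ_) (filterᵇ (_<ꟳ pos (π · w) t) (allFin n)))
      ≡⟨ cong (λ b → filterᵇ (t <ꟳ_) (map ((π · w) ⟨$⟩ʳ_) (filterᵇ (_<ꟳ b) (allFin n)))) same-pos ⟩
    filterᵇ (t <ꟳ_) (map ((π · w) ⟨$⟩ʳ_) leftOf-t)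
      ≡⟨ cong (filterᵇ (t <ꟳ_)) (map-∘ leftOf-t) ⟩
    filterᵇ (t <ꟳ_) (map (π ⟨$⟩ʳ_) (map (w ⟨$⟩ʳ_) leftOf-t))
      ≡⟨ filterᵇ-map (t <ꟳ_) (π ⟨$⟩ʳ_) (map (w ⟨$⟩ʳ_) leftOf-t) ⟩
    map (π ⟨$⟩ʳ_) (filterᵇ (λ q → t <ꟳ (π ⟨$⟩ʳ q)) (map (w ⟨$⟩ʳ_) leftOf-t))
      ≡⟨ cong (map (π ⟨$⟩ʳ_)) (filterᵇ-cong {xs = map (w ⟨$⟩ʳ_) leftOf-t} (All.tabulate (λ {q} _ → order q))) ⟩
    map (π ⟨$⟩ʳ_) (nwList w t) ∎
    where
    open ≡-Reasoning
    leftOf-t = filterᵇ (_<ꟳ pos w t) (allFin n)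
    same-pos : pos (π · w) t ≡ pos w t
    same-pos = trans (cong (pos (π · w)) (sym πt≡t)) (pos-· π w t)

module _ {k : ℕ} where

  nwList-noDescentFrom : ∀ {D} {w : Perm (suc k)} → NoDescentFrom D w → ∀ t → D ≤ toℕ t → nwList w t ≡ []
  nwList-noDescentFrom {D} {w} above t D≤t = filterᵇ-map-filterᵇ-none no-larger (allFin (suc k))
    where
    no-larger : ∀ i → (i <ꟳ pos w t) ≡ true → (t <ꟳ (w ⟨$⟩ʳ i)) ≡ false
    no-larger i i<pos = ≮⇒<ᵇ≡false λ t<wi →
      <-asym (<ᵇ≡true⇒< i<pos)
             (subst (λ j → toℕ (pos w t) < toℕ j) (inverseˡ w) (pos-increasing-from {u = w} above D≤t t<wi))

-- Peeling off the largest descent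

module _ {k : ℕ} {A B : Set} (R : ℕ → A → B → Set) {f : A → Fin k → A} {g : B → Fin k → B} where

  foldl-allFin-simulation : (∀ a {x y} → R (toℕ a) x y → R (suc (toℕ a)) (f x a) (g y a)) →
                            ∀ {x y} → R 0 x y → R k (foldl f x (allFin k)) (foldl g y (allFin k))
  foldl-allFin-simulation step = go k (λ i → i) 0 (λ _ → refl)
    where
    go : ∀ m (h : Fin m → Fin k) offset → (∀ i → toℕ (h i) ≡ offset + toℕ i) →
         ∀ {x y} → R offset x y → R (offset + m) (foldl f x (tabulate h)) (foldl g y (tabulate h))
    go zero    h offset h-shift {x} {y} r = subst (λ j → R j x y) (sym (+-identityʳ offset)) r
    go (suc m) h offset h-shift {x} {y} r =
      subst (λ j → R j (foldl f x (tabulate h)) (foldl g y (tabulate h))) (sym (+-suc offset m))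
        (go m (h ∘ suc) (suc offset) (λ i → trans (h-shift (suc i)) (+-suc offset (toℕ i)))
            (subst (λ j → R (suc j) (f x (h zero)) (g y (h zero))) h0
                   (step (h zero) (subst (λ j → R j x y) (sym h0) r))))
      where
      h0 : toℕ (h zero) ≡ offset
      h0 = trans (h-shift zero) (+-identityʳ offset)

module _ {A B : Set} {R : A → B → Set} where

  All⇒Pointwise-map : (f : A → B) → ∀ {xs} → All (λ x → R x (f x)) xs → Pointwise R xs (map f xs)
  All⇒Pointwise-map f []       = []
  All⇒Pointwise-map f (r ∷ rs) = r ∷ All⇒Pointwise-map f rs

module _ {A : Set} {R : A → A → Set} where

  All⇒Pointwise-diag : ∀ {xs} → All (λ x → R x x) xs → Pointwise R xs xs
  All⇒Pointwise-diag []       = []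
  All⇒Pointwise-diag (r ∷ rs) = r ∷ All⇒Pointwise-diag rs

module _ {k : ℕ} where

  open Hopping using (canHop; swapIf; swapsAlong)

  private
    P = Perm (suc k)

  stage : P → P → Fin k → P
  stage u x a = swapsAlong (inject₁ a) (nwList u (inject₁ a)) x

  hopAll≡foldl-stage : ∀ (w x : P) → hopAll w x ≡ foldl (stage w) x (allFin k)
  hopAll≡foldl-stage w x = foldl-cong (λ u a → Hopping.hop≡swapsAlong (inject₁ a) (nwList w (inject₁ a)) u) x (allFin k)

  stage-cong : ∀ (w : P) a {x y : P} → x ≈ y → stage w x a ≈ stage w y a
  stage-cong w a = swapsAlong-cong (inject₁ a) (nwList w (inject₁ a))

  hopAll-cong : ∀ (w : P) {x y : P} → x ≈ y → hopAll w x ≈ hopAll w y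
  hopAll-cong w {x} {y} x≈y rewrite hopAll≡foldl-stage w x | hopAll≡foldl-stage w y = go (allFin k) x≈y
    where
    go : ∀ as {x y} → x ≈ y → foldl (stage w) x as ≈ foldl (stage w) y as
    go []       x≈y = x≈y
    go (a ∷ as) x≈y = go as (stage-cong w a x≈y)

  module TopDescentStep (w : P) (d : Fin k) (descent : Descent w d) (above : NoDescentFrom (suc (toℕ d)) w) where

    d₀ d₁ : Fin (suc k)
    d₀ = inject₁ d
    d₁ = suc d

    Sw : P
    Sw = sgen d · w

    c B : Fin (suc k)
    c = pos w d₁
    B = pos w d₀

    d₀<d₁ : toℕ d₀ < toℕ d₁
    d₀<d₁ = inject₁<suc d

    left-of-c-≯d₁ : ∀ {i} → toℕ i < toℕ c → ¬ toℕ d₁ < toℕ (w ⟨$⟩ʳ i)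
    left-of-c-≯d₁ {i} i<c d₁<wi =
      <-asym i<c (subst (λ j → toℕ c < toℕ j) (inverseˡ w) (pos-increasing-from {u = w} above ≤-refl d₁<wi))

    left-of-c-≯d₀ : ∀ {i} → toℕ i < toℕ c → ¬ toℕ d₀ < toℕ (w ⟨$⟩ʳ i)
    left-of-c-≯d₀ {i} i<c d₀<wi = left-of-c-≯d₁ i<c (≤∧≢⇒< d₁≤wi (wi≢d₁ ∘ toℕ-injective ∘ sym))
      where
      d₁≤wi : toℕ d₁ ≤ toℕ (w ⟨$⟩ʳ i)
      d₁≤wi = subst (_< toℕ (w ⟨$⟩ʳ i)) (toℕ-inject₁ d) d₀<wi
      wi≢d₁ : w ⟨$⟩ʳ i ≢ d₁
      wi≢d₁ e = Finₚ.<⇒≢ i<c (trans (sym (inverseˡ w)) (cong (pos w) e))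

    σ-fixes-wi : ∀ {i} → i ≢ c → i ≢ B → σ d (w ⟨$⟩ʳ i) ≡ w ⟨$⟩ʳ i
    σ-fixes-wi {i} i≢c i≢B = σ-other d (w ⟨$⟩ʳ i) (λ e → i≢B (trans (sym (inverseˡ w)) (cong (pos w) e)))
                                                  (λ e → i≢c (trans (sym (inverseˡ w)) (cong (pos w) e)))

    pos-Sw-d₀ : pos Sw d₀ ≡ c
    pos-Sw-d₀ = trans (pos-sgen-· d w d₀) (cong (pos w) (σ-inject₁ d))

    pos-Sw-d₁ : pos Sw d₁ ≡ B
    pos-Sw-d₁ = trans (pos-sgen-· d w d₁) (cong (pos w) (σ-suc d))

    nwList-Sw-d₀ : nwList Sw d₀ ≡ []
    nwList-Sw-d₀ = filterᵇ-map-filterᵇ-none no-larger (allFin (suc k))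
      where
      no-larger : ∀ i → (i <ꟳ pos Sw d₀) ≡ true → (d₀ <ꟳ (Sw ⟨$⟩ʳ i)) ≡ false
      no-larger i i<pos =
        ≮⇒<ᵇ≡false (subst (λ x → ¬ toℕ d₀ < toℕ x) (sym (σ-fixes-wi (Finₚ.<⇒≢ i<c) (Finₚ.<⇒≢ (<-trans i<c descent))))
                                             (left-of-c-≯d₀ i<c))
        where
        i<c : toℕ i < toℕ c
        i<c = subst (λ x → toℕ i < toℕ x) pos-Sw-d₀ (<ᵇ≡true⇒< i<pos)

    leftOf-B : List (Fin (suc k))
    leftOf-B = filterᵇ (_<ꟳ B) (allFin (suc k))

    nwList-w-d₀ : nwList w d₀ ≡ d₁ ∷ nwList Sw d₁
    nwList-w-d₀ = begin
      filterᵇ (d₀ <ꟳ_) (map (w ⟨$⟩ʳ_) leftOf-B)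
        ≡⟨ filterᵇ-map-extra-head (d₀ <ꟳ_) (d₁ <ꟳ_) (w ⟨$⟩ʳ_) (Sw ⟨$⟩ʳ_) c sorted c∈leftOf-B before keep drop after ⟩
      (w ⟨$⟩ʳ c) ∷ filterᵇ (d₁ <ꟳ_) (map (Sw ⟨$⟩ʳ_) leftOf-B)
        ≡⟨ cong₂ _∷_ (inverseʳ w) (cong (λ b → filterᵇ (d₁ <ꟳ_) (map (Sw ⟨$⟩ʳ_) (filterᵇ (_<ꟳ b) (allFin (suc k)))))
                                        (sym pos-Sw-d₁)) ⟩
      d₁ ∷ nwList Sw d₁ ∎
      where
      open ≡-Reasoning
      sorted = AllPairs.filter⁺ (T? ∘ (_<ꟳ B)) (AllPairs.tabulate⁺-< {R = λ i j → toℕ i < toℕ j} (λ i<j → i<j))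
      c∈leftOf-B : c ∈ leftOf-B
      c∈leftOf-B = ∈-filter⁺ (T? ∘ (_<ꟳ B)) (∈-allFin c) (<⇒<ᵇ descent)
      below-B : All (λ i → toℕ i < toℕ B) leftOf-B
      below-B = All.map (λ {i} → <ᵇ⇒< (toℕ i) (toℕ B)) (all-filter (T? ∘ (_<ꟳ B)) (allFin (suc k)))
      before : All (λ i → toℕ i < toℕ c → (d₀ <ꟳ (w ⟨$⟩ʳ i)) ≡ false × (d₁ <ꟳ (Sw ⟨$⟩ʳ i)) ≡ false) leftOf-B
      before = All.map (λ {i} i<B i<c →
        ≮⇒<ᵇ≡false (left-of-c-≯d₀ i<c) ,
        ≮⇒<ᵇ≡false (subst (λ x → ¬ toℕ d₁ < toℕ x) (sym (σ-fixes-wi (Finₚ.<⇒≢ i<c) (Finₚ.<⇒≢ i<B)))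
                          (left-of-c-≯d₁ i<c))) below-B
      keep : (d₀ <ꟳ (w ⟨$⟩ʳ c)) ≡ true
      keep = subst (λ x → (d₀ <ꟳ x) ≡ true) (sym (inverseʳ w)) (<⇒<ᵇ≡true d₀<d₁)
      drop : (d₁ <ꟳ (Sw ⟨$⟩ʳ c)) ≡ false
      drop = subst (λ x → (d₁ <ꟳ σ d x) ≡ false) (sym (inverseʳ w))
                   (subst (λ x → (d₁ <ꟳ x) ≡ false) (sym (σ-suc d)) (≮⇒<ᵇ≡false (<-asym d₀<d₁)))
      after : All (λ i → toℕ c < toℕ i → w ⟨$⟩ʳ i ≡ Sw ⟨$⟩ʳ i × (d₀ <ꟳ (w ⟨$⟩ʳ i)) ≡ (d₁ <ꟳ (Sw ⟨$⟩ʳ i))) leftOf-B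
      after = All.map (λ {i} i<B c<i →
        let fixed = σ-fixes-wi (>⇒≢ c<i) (Finₚ.<⇒≢ i<B)
            wi≢d₁ : w ⟨$⟩ʳ i ≢ d₁
            wi≢d₁ e = >⇒≢ c<i (trans (sym (inverseˡ w)) (cong (pos w) e))
        in  sym fixed ,
            trans (cong (_<ᵇ toℕ (w ⟨$⟩ʳ i)) (toℕ-inject₁ d))
                  (trans (sym (suc-<ᵇ≡<ᵇ (toℕ (w ⟨$⟩ʳ i)) (toℕ d) (wi≢d₁ ∘ toℕ-injective)))
                         (cong (d₁ <ꟳ_) (sym fixed)))) below-B

    S : P → P
    S u = sgen d · u

    L′ : List (Fin (suc k))
    L′ = nwList Sw d₁

    swapIf-d₀-d₁ : ∀ v → swapIf d₀ d₁ v ≈ sStar d (S v)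
    swapIf-d₀-d₁ v with descent? v d
    ... | yes dv rewrite sStar-ascent (S v) d (descent⇒¬descent-sgen-· v d dv) | <⇒<ᵇ≡true d₀<d₁
                       | ≮⇒<ᵇ≡false (<-asym dv) =
      λ i → sym (σ-involutive d (v ⟨$⟩ʳ i))
    ... | no ¬dv rewrite sStar-descent (S v) d (¬descent⇒descent-sgen-· v d ¬dv) | <⇒<ᵇ≡true d₀<d₁
                       | <⇒<ᵇ≡true (¬descent⇒< v d ¬dv) = λ _ → refl

    σ-order : ∀ t b → (t <ꟳ d₀) ≡ b → (t <ꟳ d₁) ≡ b → ∀ q → (t <ꟳ σ d q) ≡ (t <ꟳ q)
    σ-order t b t<d₀ t<d₁ q = by-cases (q ≟ d₀) (q ≟ d₁)
      where
      by-cases : Dec (q ≡ d₀) → Dec (q ≡ d₁) → (t <ꟳ σ d q) ≡ (t <ꟳ q)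
      by-cases (yes refl) _          = trans (cong (t <ꟳ_) (σ-inject₁ d)) (trans t<d₁ (sym t<d₀))
      by-cases (no _)     (yes refl) = trans (cong (t <ꟳ_) (σ-suc d)) (trans t<d₀ (sym t<d₁))
      by-cases (no q≢d₀)  (no q≢d₁)  = cong (t <ꟳ_) (σ-other d q q≢d₀ q≢d₁)

    nwList-Sw-below : ∀ t → toℕ t < toℕ d₀ → nwList Sw t ≡ map (σ d) (nwList w t)
    nwList-Sw-below t t<d₀ = nwList-relabel (sgen d) w t (σ-other d t (Finₚ.<⇒≢ t<d₀) (Finₚ.<⇒≢ t<d₁))
                                            (σ-order t true (<⇒<ᵇ≡true t<d₀) (<⇒<ᵇ≡true t<d₁))
      where t<d₁ = <-trans t<d₀ d₀<d₁

    nwList-w-above : ∀ t → toℕ d₀ < toℕ t → nwList w t ≡ []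
    nwList-w-above t d₀<t = nwList-noDescentFrom {w = w} above t (subst (_< toℕ t) (toℕ-inject₁ d) d₀<t)

    nwList-Sw-above : ∀ t → toℕ d₁ < toℕ t → nwList Sw t ≡ []
    nwList-Sw-above t d₁<t =
      trans (nwList-relabel (sgen d) w t (σ-other d t (>⇒≢ d₀<t) (>⇒≢ d₁<t))
                            (σ-order t false (≮⇒<ᵇ≡false (<-asym d₀<t)) (≮⇒<ᵇ≡false (<-asym d₁<t))))
            (cong (map (σ d)) (nwList-w-above t d₀<t))
      where d₀<t = <-trans d₀<d₁ d₁<t

    stage-below : ∀ a → toℕ (inject₁ a) < toℕ d₀ → ∀ {X Y} → Y ≈ S X → stage Sw Y a ≈ S (stage w X a)
    stage-below a t<d₀ {X} {Y} Y≈SX rewrite nwList-Sw-below (inject₁ a) t<d₀ = λ i →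
      trans (swapsAlong-cong t (map (σ d) (nwList w t)) Y≈SX i)
            (swapsAlong-relabel (sgen d) σt≡t
               (All⇒Pointwise-map (σ d) (All.tabulate {xs = nwList w t} (λ {q} _ → refl , order q))) X i)
      where
      t = inject₁ a
      t<d₁ = <-trans t<d₀ d₀<d₁
      σt≡t : σ d t ≡ t
      σt≡t = σ-other d t (Finₚ.<⇒≢ t<d₀) (Finₚ.<⇒≢ t<d₁)
      order : ∀ q → (t <ꟳ q) ≡ (t <ꟳ σ d q)
      order q = sym (σ-order t true (<⇒<ᵇ≡true t<d₀) (<⇒<ᵇ≡true t<d₁) q)

    swapsAlong-L′ : ∀ z → swapsAlong d₁ L′ (S z) ≈ S (swapsAlong d₀ L′ z)
    swapsAlong-L′ z = swapsAlong-relabel (sgen d) (σ-inject₁ d) (All⇒Pointwise-diag (All.map same-side L′-above-d₁)) z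
      where
      L′-above-d₁ : All (T ∘ (d₁ <ꟳ_)) L′
      L′-above-d₁ = all-filter (T? ∘ (d₁ <ꟳ_)) (map (Sw ⟨$⟩ʳ_) (filterᵇ (_<ꟳ pos Sw d₁) (allFin (suc k))))
      same-side : ∀ {q} → T (d₁ <ꟳ q) → σ d q ≡ q × (d₀ <ꟳ q) ≡ (d₁ <ꟳ q)
      same-side {q} d₁<q = σ-other d q (>⇒≢ (<-trans d₀<d₁ lt)) (>⇒≢ lt) ,
                           trans (<⇒<ᵇ≡true (<-trans d₀<d₁ lt)) (sym (<⇒<ᵇ≡true lt))
        where lt = <ᵇ⇒< (toℕ d₁) (toℕ q) d₁<q

    inject₁≡d₁ : ∀ a → toℕ a ≡ suc (toℕ d) → inject₁ a ≡ d₁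
    inject₁≡d₁ a a≡1+d = toℕ-injective (trans (toℕ-inject₁ a) a≡1+d)

    -- After m stages: below d the two computations are conjugate by s_d; stage d of w leaves one conditional
    -- swap of d and d+1 pending, which stage d+1 of s_d w settles; from then on no stage moves anything.
    data Related (m : ℕ) (X Y : P) : Set where
      before  : m ≤ toℕ d → Y ≈ S X → Related m X Y
      pending : m ≡ suc (toℕ d) → ∀ z → X ≡ swapIf d₀ d₁ (swapsAlong d₀ L′ z) → Y ≈ S z → Related m X Y
      after   : suc (toℕ d) < m → X ≈ sStar d Y → Related m X Y

    related-step : ∀ a {X Y} → Related (toℕ a) X Y → Related (suc (toℕ a)) (stage w X a) (stage Sw Y a)
    related-step a (before a≤d Y≈SX) with <-cmp (toℕ a) (toℕ d)
    ... | tri< a<d _ _ = before a<d (stage-below a (subst₂ _<_ (sym (toℕ-inject₁ a)) (sym (toℕ-inject₁ d)) a<d) Y≈SX)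
    ... | tri> _ _ d<a = contradiction a≤d (<⇒≱ d<a)
    ... | tri≈ _ a≡d _ with toℕ-injective a≡d
    ...   | refl rewrite nwList-w-d₀ | nwList-Sw-d₀ = pending refl _ refl Y≈SX
    related-step a {X} {Y} (pending a≡1+d z X≡ Y≈Sz) rewrite inject₁≡d₁ a a≡1+d | nwList-w-above d₁ d₀<d₁ =
      after (s≤s (≤-reflexive (sym a≡1+d))) (begin
        X                                  ≡⟨ X≡ ⟩
        swapIf d₀ d₁ (swapsAlong d₀ L′ z)  ≈⟨ swapIf-d₀-d₁ (swapsAlong d₀ L′ z) ⟩
        sStar d (S (swapsAlong d₀ L′ z))   ≈⟨ sStar-cong d {swapsAlong d₁ L′ Y} {S (swapsAlong d₀ L′ z)} hopped ⟨
        sStar d (swapsAlong d₁ L′ Y)       ∎)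
      where
      open ≈-Reasoning
      hopped : swapsAlong d₁ L′ Y ≈ S (swapsAlong d₀ L′ z)
      hopped j = trans (swapsAlong-cong d₁ L′ Y≈Sz j) (swapsAlong-L′ z j)
    related-step a (after 1+d<a X≈⋆Y)
      rewrite nwList-w-above (inject₁ a)
                (subst₂ _<_ (sym (toℕ-inject₁ d)) (sym (toℕ-inject₁ a)) (<-trans (n<1+n _) 1+d<a))
            | nwList-Sw-above (inject₁ a) (subst (suc (toℕ d) <_) (sym (toℕ-inject₁ a)) 1+d<a) =
      after (<-trans 1+d<a (n<1+n _)) X≈⋆Y

    L′-empty : k ≡ suc (toℕ d) → L′ ≡ []
    L′-empty k≡1+d = filterᵇ-map-filterᵇ-none {p = d₁ <ꟳ_} {Sw ⟨$⟩ʳ_} {_<ꟳ pos Sw d₁} nothing-above (allFin (suc k))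
      where
      nothing-above : ∀ i → _ → (d₁ <ꟳ (Sw ⟨$⟩ʳ i)) ≡ false
      nothing-above i _ = ≮⇒<ᵇ≡false (≤⇒≯ (subst (toℕ (Sw ⟨$⟩ʳ i) ≤_) k≡1+d (≤-pred (toℕ<n (Sw ⟨$⟩ʳ i)))))

    related-end : ∀ {X Y} → Related k X Y → X ≈ sStar d Y
    related-end (before k≤d _) = contradiction (toℕ<n d) (≤⇒≯ k≤d)
    related-end {X} {Y} (pending k≡1+d z X≡ Y≈Sz) = begin
      X               ≡⟨ trans X≡ (cong (λ L → swapIf d₀ d₁ (swapsAlong d₀ L z)) (L′-empty k≡1+d)) ⟩
      swapIf d₀ d₁ z  ≈⟨ swapIf-d₀-d₁ z ⟩
      sStar d (S z)   ≈⟨ sStar-cong d {S z} {Y} (≈-sym {u = Y} {S z} Y≈Sz) ⟩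
      sStar d Y       ∎
      where open ≈-Reasoning
    related-end (after _ X≈⋆Y) = X≈⋆Y

    hopAll-peel : ∀ x → hopAll w x ≈ sStar d (hopAll Sw (S x))
    hopAll-peel x rewrite hopAll≡foldl-stage w x | hopAll≡foldl-stage Sw (S x) =
      related-end (foldl-allFin-simulation Related related-step (before z≤n (λ _ → refl)))

-- Induction on the length

module _ {k : ℕ} where

  private
    P = Perm (suc k)

  HoppingFormula : P → Set
  HoppingFormula w = ∀ as v → IsReducedWord w as → demazureWord as v ≈ hopAll w (w · v)

  hopAll-noDescent : ∀ {w : P} → NoDescentFrom 0 w → ∀ x → hopAll w x ≡ x
  hopAll-noDescent {w} above x = trans (hopAll≡foldl-stage w x) (go (allFin k) x)
    where
    go : ∀ as x → foldl (stage w) x as ≡ x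
    go []       x = refl
    go (a ∷ as) x rewrite nwList-noDescentFrom {w = w} above (inject₁ a) z≤n = go as x

  hopAll-topDescent : ∀ (w : P) d → Descent w d → NoDescentFrom (suc (toℕ d)) w → ∀ v →
                      hopAll w (w · v) ≈ sStar d (hopAll (sgen d · w) ((sgen d · w) · v))
  hopAll-topDescent w d dd above v = begin
    hopAll w (w · v)                                  ≈⟨ TopDescentStep.hopAll-peel {k} w d dd above (w · v) ⟩
    sStar d (hopAll (sgen d · w) (sgen d · (w · v)))  ≈⟨ sStar-cong d (hopAll-cong (sgen d · w) (λ _ → refl)) ⟩
    sStar d (hopAll (sgen d · w) ((sgen d · w) · v))  ∎
    where open ≈-Reasoning

  module Exchange (m : ℕ) (IH : ∀ (u : P) → len u ≡ m → HoppingFormula u) (v : P) where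

    H : P → P
    H u = hopAll u (u · v)

    open ≈-Reasoning

    len-after : ∀ (w : P) (a : Fin k) → Descent w a → len w ≡ suc m → len (sgen a · w) ≡ m
    len-after w a da ℓw = suc-injective (trans (sym (len-descent w a da)) ℓw)

    IH-sgen : ∀ (w : P) a → Descent w a → len w ≡ suc m → ∀ β → IsReducedWord (sgen a · w) β →
              demazureWord β v ≈ H (sgen a · w)
    IH-sgen w a da ℓw β = IH (sgen a · w) (len-after w a da ℓw) β v

    exchange-far : ∀ (w : P) a d → Far a d → Descent w a → Descent w d → len w ≡ suc m →
                   sStar a (H (sgen a · w)) ≈ sStar d (H (sgen d · w))
    exchange-far w a d far da dd ℓw with reducedWord-exists (sgen a · (sgen d · w))
    ... | β , red = begin
      sStar a (H (sgen a · w))  ≈⟨ sStar-cong a {sStar d D} {H (sgen a · w)} (IH-sgen w a da ℓw (d ∷ β) red-a) ⟨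
      sStar a (sStar d D)       ≈⟨ sStar-commute {a = a} {d} far D ⟩
      sStar d (sStar a D)       ≈⟨ sStar-cong d {sStar a D} {H (sgen d · w)} (IH-sgen w d dd ℓw (a ∷ β) red-d) ⟩
      sStar d (H (sgen d · w))  ∎
      where
      D = demazureWord β v
      red-a : IsReducedWord (sgen a · w) (d ∷ β)
      red-a = reducedWord-∷⁺ {w = sgen a · w} {d} {β} (descent-far⁺ {a = d} {a} (far-sym {a = a} {d} far) w dd)
                (reducedWord-cong {u = sgen a · (sgen d · w)} {sgen d · (sgen a · w)} {β}
                                  (sgen-commute {a = a} {d} far w) red)
      red-d : IsReducedWord (sgen d · w) (a ∷ β)
      red-d = reducedWord-∷⁺ {w = sgen d · w} {a} {β} (descent-far⁺ {a = a} {d} far w da) red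

    exchange-adjacent : ∀ (w : P) a d → toℕ d ≡ suc (toℕ a) → Descent w a → Descent w d → len w ≡ suc m →
                        sStar a (H (sgen a · w)) ≈ sStar d (H (sgen d · w))
    exchange-adjacent w a d d≡1+a da dd ℓw with reducedWord-exists (sgen a · (sgen d · (sgen a · w)))
    ... | β , red = begin
      sStar a (H (sgen a · w))
        ≈⟨ sStar-cong a {sStar d (sStar a D)} {H (sgen a · w)} (IH-sgen w a da ℓw (d ∷ a ∷ β) red-a) ⟨
      sStar a (sStar d (sStar a D))
        ≈⟨ sStar-braid D ⟩
      sStar d (sStar a (sStar d D))
        ≈⟨ sStar-cong d {sStar a (sStar d D)} {H (sgen d · w)} (IH-sgen w d dd ℓw (a ∷ d ∷ β) red-d) ⟩
      sStar d (H (sgen d · w))       ∎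
      where
      open Braid a d d≡1+a
      D = demazureWord β v
      red-a : IsReducedWord (sgen a · w) (d ∷ a ∷ β)
      red-a = reducedWord-∷⁺ {w = sgen a · w} {d} {a ∷ β} (proj₁ (descents-after-sa w da dd))
                (reducedWord-∷⁺ {w = sgen d · (sgen a · w)} {a} {β} (proj₂ (descents-after-sa w da dd)) red)
      red-d : IsReducedWord (sgen d · w) (a ∷ d ∷ β)
      red-d = reducedWord-∷⁺ {w = sgen d · w} {a} {d ∷ β} (proj₁ (descents-after-sd w da dd))
                (reducedWord-∷⁺ {w = sgen a · (sgen d · w)} {d} {β} (proj₂ (descents-after-sd w da dd))
                  (reducedWord-cong {u = sgen a · (sgen d · (sgen a · w))} {sgen d · (sgen a · (sgen d · w))} {β}
                                    (braid w) red))

    exchange-< : ∀ (w : P) a d → toℕ a < toℕ d → Descent w a → Descent w d → len w ≡ suc m →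
                 sStar a (H (sgen a · w)) ≈ sStar d (H (sgen d · w))
    exchange-< w a d a<d with toℕ d ℕ.≟ suc (toℕ a)
    ... | yes d≡1+a = exchange-adjacent w a d d≡1+a
    ... | no  d≢1+a = exchange-far w a d (inj₁ (≤∧≢⇒< a<d (d≢1+a ∘ sym)))

    exchange : ∀ (w : P) a d → Descent w a → Descent w d → len w ≡ suc m →
               sStar a (H (sgen a · w)) ≈ sStar d (H (sgen d · w))
    exchange w a d da dd ℓw with <-cmp (toℕ a) (toℕ d)
    ... | tri< a<d _ _ = exchange-< w a d a<d da dd ℓw
    ... | tri> _ _ d<a = ≈-sym {u = sStar d (H (sgen d · w))} {sStar a (H (sgen a · w))} (exchange-< w d a d<a dd da ℓw)
    ... | tri≈ _ a≡d _ rewrite toℕ-injective a≡d = ≈-refl {u = sStar d (H (sgen d · w))}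

  hoppingFormula : ∀ m (w : P) → len w ≡ m → HoppingFormula w
  hoppingFormula _ w _ [] v (id≈w , _) = begin
    v                 ≈⟨ ·-cong {u = id} {w} {v} {v} id≈w (≈-refl {u = v}) ⟩
    w · v             ≡⟨ hopAll-noDescent {w = w} (≈id⇒noDescent {u = w} (≈-sym {u = id} {w} id≈w)) (w · v) ⟨
    hopAll w (w · v)  ∎
    where open ≈-Reasoning
  hoppingFormula zero w ℓw (a ∷ α) v red =
    contradiction (trans (sym ℓw) (len-descent w a (proj₁ (reducedWord-∷⁻ {w = w} {a} {α} red)))) λ ()
  hoppingFormula (suc m) w ℓw (a ∷ α) v red with reducedWord-∷⁻ {w = w} {a} {α} red | topDescent w
  ... | da , _     | none above     = contradiction da (above a z≤n)
  ... | da , red-α | top d dd above = begin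
    sStar a (demazureWord α v)  ≈⟨ sStar-cong a {demazureWord α v} {H (sgen a · w)} (IH-sgen w a da ℓw α red-α) ⟩
    sStar a (H (sgen a · w))    ≈⟨ exchange w a d da dd ℓw ⟩
    sStar d (H (sgen d · w))    ≈⟨ hopAll-topDescent w d dd above v ⟨
    H w                         ∎
    where
    open ≈-Reasoning
    open Exchange m (λ u ℓu → hoppingFormula m u ℓu) v

theorem3p1 : (k : ℕ) → 1 ≤ k → (w v : Perm (suc k)) → (as : List (Fin k)) →
    IsReducedWord w as → demazureWord as v ≈ hopAll w (w · v)
theorem3p1 k _ w v as red = hoppingFormula (len w) w refl as v red
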